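{- Let $q$ be an odd prime power, $n\geq 3$ odd, $\xi$ a non-square in $\mathbb{F}_q$, $r$ an integer with $\gcd(n,r)=1$, $b\in\mathbb{F}_{q^n}^*$ with $N_q(b)\neq\pm1$, $H_{b,r}(x)=x-bx^{q^r}$ and $B_{b,r}(x)=2H_{b,r}^{ -1}(x)-x$. Then the $\mathbb{F}_q$-linear set $$L_{\mathcal{D}_B}=\{\langle(x,y,B_{b,r}(y),\xi B_{b,r}(x))\rangle : x,y\in\mathbb{F}_{q^n},\ (x,y)\neq(0,0)\}\subset PG(3,q^n)$$ is a maximum scattered $\mathbb{F}_q$-linear set of pseudoregulus type whose two transversal lines are external to the quadric $\mathcal{Q}: X_0X_3-X_1X_2=0$ and are polar to each other with respect to the polarity defined by $\mathcal{Q}$.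
   Context: $N_q$ denotes the norm from $\mathbb{F}_{q^n}$ to $\mathbb{F}_q$. For an $\mathbb{F}_q$-subspace $U$ of $\mathbb{F}_{q^n}^4$, $L_U=\{\langle\mathbf u\rangle:\mathbf u\in U\setminus\{0\}\}$ is an $\mathbb{F}_q$-linear set of rank $\dim_{\mathbb{F}_q}U$; the weight of a subspace $PG(W,\mathbb{F}_{q^n})$ in $L_U$ is $\dim_{\mathbb{F}_q}(W\cap U)$. $L_U$ is maximum scattered in $PG(3,q^n)$ if all its points have weight $1$ and its rank is $2n$; a long line is a line of weight $n$. A maximum scattered $\mathbb{F}_q$-linear set $L$ of $PG(3,q^n)$ is of pseudoregulus type if there exist $q^n+1$ pairwise disjoint long lines of $L$ and exactly two lines $T_1,T_2$ disjoint from $L$ meeting each of these long lines; $T_1,T_2$ are called the transversal lines of $L$. -}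

module Defs where

open import Level using (0ℓ)
open import Data.Nat as ℕ using (ℕ; zero; suc)
open import Data.Nat.Primality using (Prime)
open import Data.Integer as ℤ using (ℤ; _%ℕ_)
open import Data.Fin using (Fin)
open import Data.Vec using (Vec; []; _∷_)
open import Data.Vec.Relation.Unary.All using (All)
open import Data.Product using (Σ; ∃; _×_; _,_)
open import Data.Sum using (_⊎_)
open import Relation.Nullary using (¬_)
open import Relation.Binary.PropositionalEquality using (_≡_; _≢_)
open import Algebra.Structures using (IsCommutativeRing)
open import Function.Bundles using (_↔_)

IsPrimePower : ℕ → Set
IsPrimePower q = Σ ℕ λ p → Σ ℕ λ e → Prime p × 1 ℕ.≤ e × q ≡ p ℕ.^ e

Odd : ℕ → Set
Odd m = m ℕ.% 2 ≡ 1

record FiniteField : Set₁ where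
  infixl 6 _+_
  infixl 7 _*_
  infix 8 -_
  field
    Carrier : Set
    _+_ _*_ : Carrier → Carrier → Carrier
    -_      : Carrier → Carrier
    0# 1#   : Carrier
    isCommutativeRing : IsCommutativeRing _≡_ _+_ _*_ -_ 0# 1#
    0≢1     : 0# ≢ 1#
    inverse : ∀ x → x ≢ 0# → ∃ λ y → x * y ≡ 1#
    size    : ℕ
    enum    : Fin size ↔ Carrier

-- Geometry over a finite field K = F_{q^n}, with F_q its subfield of
-- elements fixed by x ↦ x^q.

module Geom (F : FiniteField) (q n : ℕ) where
  open FiniteField F renaming (Carrier to K) public

  infixl 6 _-_
  _-_ : K → K → K
  x - y = x + (- y)

  infixr 8 _^_
  _^_ : K → ℕ → K
  x ^ zero  = 1#
  x ^ suc k = x * (x ^ k)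

  InFq : K → Set
  InFq x = x ^ q ≡ x

  NonSquareFq : K → Set
  NonSquareFq ξ = InFq ξ × (∀ z → InFq z → ¬ (z * z ≡ ξ))

  -- the norm N_q : F_{q^n} → F_q,  N_q(x) = x^{(q^n - 1)/(q - 1)} = x^{1+q+...+q^{n-1}}
  normExp : ℕ → ℕ
  normExp zero    = 0
  normExp (suc k) = q ℕ.^ k ℕ.+ normExp k

  Norm : K → K
  Norm x = x ^ normExp n

  -- x ↦ x^{q^r} for r ∈ ℤ (well defined since x^{q^n} = x); exponent q^(r mod n)
  modN : ℕ → ℤ → ℕ
  modN zero    r = 0
  modN (suc m) r = r %ℕ suc m

  rmod : ℤ → ℕ
  rmod r = modN n r

  frob : ℤ → K → K
  frob r x = x ^ (q ℕ.^ rmod r)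

  H : K → ℤ → K → K
  H b r x = x - b * frob r x

  two : K
  two = 1# + 1#

  record V4 : Set where
    constructor ⟨_,_,_,_⟩
    field c0 c1 c2 c3 : K

  zeroV : V4
  zeroV = ⟨ 0# , 0# , 0# , 0# ⟩

  _⊕_ : V4 → V4 → V4
  ⟨ a , b , c , d ⟩ ⊕ ⟨ a' , b' , c' , d' ⟩ = ⟨ a + a' , b + b' , c + c' , d + d' ⟩

  _•_ : K → V4 → V4
  λ' • ⟨ a , b , c , d ⟩ = ⟨ λ' * a , λ' * b , λ' * c , λ' * d ⟩

  Pred : Set₁
  Pred = V4 → Set

  lincomb : ∀ {k} → Vec K k → Vec V4 k → V4
  lincomb []       []       = zeroV
  lincomb (c ∷ cs) (v ∷ vs) = (c • v) ⊕ lincomb cs vs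

  FqIndependent : ∀ {k} → Vec V4 k → Set
  FqIndependent {k} vs =
    (cs : Vec K k) → All InFq cs → lincomb cs vs ≡ zeroV → All (_≡ 0#) cs

  FqSpans : ∀ {k} → Pred → Vec V4 k → Set
  FqSpans {k} S vs =
    All S vs × (∀ v → S v → Σ (Vec K k) λ cs → All InFq cs × v ≡ lincomb cs vs)

  HasFqDim : Pred → ℕ → Set
  HasFqDim S k = Σ (Vec V4 k) λ vs → FqIndependent vs × FqSpans S vs

  -- Projective notions in PG(3, q^n): a point is ⟨v⟩ for v ≠ 0.

  InL : Pred → V4 → Set
  InL U v = ∃ λ μ → U (μ • v) × μ • v ≢ zeroV

  SpanK : V4 → Pred
  SpanK v w = ∃ λ μ → w ≡ μ • v

  _∩_ : Pred → Pred → Pred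
  (S ∩ T) v = S v × T v

  MaximumScattered : Pred → Set
  MaximumScattered U =
    HasFqDim U (2 ℕ.* n) ×
    (∀ v → v ≢ zeroV → InL U v → HasFqDim (SpanK v ∩ U) 1)

  record Line : Set where
    constructor line
    field
      u w   : V4
      indep : ∀ α β → (α • u) ⊕ (β • w) ≡ zeroV → α ≡ 0# × β ≡ 0#

  OnLine : Line → Pred
  OnLine (line u w _) v = ∃ λ α → ∃ λ β → v ≡ (α • u) ⊕ (β • w)

  SameLine : Line → Line → Set
  SameLine ℓ ℓ' = ∀ v → (OnLine ℓ v → OnLine ℓ' v) × (OnLine ℓ' v → OnLine ℓ v)

  LongLine : Pred → Line → Set
  LongLine U ℓ = HasFqDim (OnLine ℓ ∩ U) n

  DisjointLines : Line → Line → Set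
  DisjointLines ℓ ℓ' = ∀ v → OnLine ℓ v → OnLine ℓ' v → v ≡ zeroV

  DisjointFromL : Pred → Line → Set
  DisjointFromL U T = ∀ v → OnLine T v → v ≢ zeroV → ¬ InL U v

  Meet : Line → Line → Set
  Meet T ℓ = ∃ λ v → v ≢ zeroV × OnLine T v × OnLine ℓ v

  Transversal : Pred → (Fin (q ℕ.^ n ℕ.+ 1) → Line) → Line → Set
  Transversal U ℓs T = DisjointFromL U T × (∀ i → Meet T (ℓs i))

  PseudoregulusWith : Pred → (Fin (q ℕ.^ n ℕ.+ 1) → Line) → Line → Line → Set
  PseudoregulusWith U ℓs T₁ T₂ =
    MaximumScattered U ×
    (∀ i → LongLine U (ℓs i)) ×
    (∀ i j → i ≢ j → DisjointLines (ℓs i) (ℓs j)) ×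
    Transversal U ℓs T₁ × Transversal U ℓs T₂ × ¬ SameLine T₁ T₂ ×
    (∀ T → Transversal U ℓs T → SameLine T T₁ ⊎ SameLine T T₂)

  Qform : V4 → K
  Qform ⟨ x0 , x1 , x2 , x3 ⟩ = x0 * x3 - x1 * x2

  -- the symmetric bilinear form associated with Q (polarity of Q; q odd)
  Qpolar : V4 → V4 → K
  Qpolar ⟨ x0 , x1 , x2 , x3 ⟩ ⟨ y0 , y1 , y2 , y3 ⟩ =
    ((x0 * y3 + x3 * y0) - x1 * y2) - x2 * y1

  ExternalToQ : Line → Set
  ExternalToQ T = ∀ v → OnLine T v → v ≢ zeroV → Qform v ≢ 0#

  PolarLines : Line → Line → Set
  PolarLines T₁ T₂ =
    ∀ v → (OnLine T₂ v → ∀ u → OnLine T₁ u → Qpolar u v ≡ 0#)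
        × ((∀ u → OnLine T₁ u → Qpolar u v ≡ 0#) → OnLine T₂ v)

  DB : (K → K) → K → Pred
  DB B ξ v = ∃ λ x → ∃ λ y → v ≡ ⟨ x , y , B y , ξ * B x ⟩

{-# OPTIONS --safe #-}

-- Write σ(x) = x^(q^r). Substituting x = H(a) and y = H(c) turns the set into
-- {(a − a′, c − c′, c + c′, ξ(a + a′))} with a′ = bσ(a) and c′ = bσ(c), that is,
-- into the graph of u ↦ bσ(u) with respect to the decomposition of the space into
-- T₁ = {(α, β, β, ξα)} and T₂ = {(−α, −β, β, ξα)}. A scalar preserving the graph
-- at a nonzero vector is fixed by σ, hence lies in F_q. The long lines join the
-- points P of T₁ to σ(P) in T₂. A line meeting those at (1,0), (0,1) and (1,1) has
-- the form {(s u, t u)}, and if it also meets the one at (1,ω) with σ(ω) ≠ ω, then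
-- s = 0 or t = 0. On T₁ and T₂ the quadratic form is ±(ξα² − β²), anisotropic since
-- ξ remains a non-square in F_{q^n} for odd n. That F_{q^n} has dimension n over the
-- fixed field of x ↦ x^q follows once this field is known to have q elements, which
-- is proved by counting roots of x^q − x and of (x^(q^n−1) − 1) / (x^(q−1) − 1).

module Submission where

open import Defs
open import Level using (0ℓ)
open import Data.Nat as ℕ using (ℕ; zero; suc; _≤_)
open import Data.Nat.Base using (_!; NonZero)
import Data.Nat.Properties as ℕ
open import Data.Nat.Primality using (Prime; prime⇒nonZero; prime⇒nonTrivial; euclidsLemma)
open import Data.Nat.Divisibility using (_∣_; divides; ∣⇒≤; m∣m*n)
open import Data.Nat.DivMod using (m/n*n≡m; m≡m%n+[m/n]*n)
open import Data.Nat.Combinatorics using (_C_; nCk≡n!/k![n-k]!; k![n∸k]!∣n!; nCn≡1)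
open import Data.Nat.GCD using (module Bézout)
open import Data.Nat.Coprimality using (Coprime; coprime-Bézout)
open import Data.Integer as ℤ using (ℤ; ∣_∣)
open import Data.Integer.DivMod using (a≡a%ℕn+[a/ℕn]*n)
import Data.Integer.Divisibility.Signed as ℤ
open import Data.Fin as Fin using (Fin; zero; suc; toℕ; fromℕ; inject₁; remQuot; combine; splitAt; join; _↑ˡ_; _↑ʳ_)
import Data.Fin.Properties as Fin
open import Data.Fin.Permutation using (permutation)
open import Data.List as List using (List; []; _∷_; length; filter; tabulate)
open import Data.List.Properties using (length-tabulate)
open import Data.List.Membership.Propositional using (_∈_)
open import Data.List.Membership.Propositional.Properties using (∈-filter⁺; ∈-tabulate⁺; ∈-lookup)
open import Data.List.Relation.Unary.All as ListAll using ([]; _∷_)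
open import Data.List.Relation.Unary.All.Properties using (all-filter)
open import Data.List.Relation.Unary.Any as Any using ()
open import Data.List.Relation.Unary.Any.Properties using (lookup-index)
open import Data.List.Relation.Unary.AllPairs using ([]; _∷_)
open import Data.List.Relation.Unary.Unique.Propositional using (Unique)
open import Data.List.Relation.Unary.Unique.Propositional.Properties using (tabulate⁺; filter⁺)
open import Data.Maybe as Maybe using (Maybe)
open import Data.Product using (Σ; ∃; _×_; _,_; proj₁; proj₂; uncurry)
open import Data.Product.Properties using (≡-dec)
open import Data.Sum using (_⊎_; inj₁; inj₂)
open import Data.Vec as Vec using (Vec; []; _∷_; _∷ʳ_; _++_)
open import Data.Vec.Relation.Unary.All as All using (All; []; _∷_)
import Data.Vec.Relation.Unary.All.Properties as All
open import Function using (_∘_)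
open import Function.Bundles using (Inverse)
open import Relation.Nullary using (¬_; Dec; yes; no; contradiction)
open import Relation.Nullary.Decidable using (map′; dec⇒maybe; decidable-stable)
open import Relation.Unary using (Decidable)
open import Relation.Unary.Properties using (∁?)
open import Relation.Binary.Definitions using (DecidableEquality)
open import Relation.Binary.PropositionalEquality
open import Algebra.Bundles using (CommutativeRing; CommutativeMonoid; RawRing)
open import Algebra.Solver.Ring.AlmostCommutativeRing
  using (AlmostCommutativeRing; fromCommutativeRing; _-Raw-AlmostCommutative⟶_)
import Algebra.Solver.Ring
import Algebra.Solver.Ring.NaturalCoefficients.Default
import Algebra.Properties.AbelianGroup
import Algebra.Properties.CommutativeMonoid.Sum
import Algebra.Properties.CommutativeSemiring.Binomial
import Algebra.Properties.CommutativeSemiring.Exp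
import Algebra.Properties.Group
import Algebra.Properties.Ring
import Algebra.Properties.Semiring.Exp
import Algebra.Properties.Semiring.Mult
import Algebra.Properties.Semiring.Mult.TCOptimised

-- T₁ and T₂ are the eigenspaces, for 1 and -1, of the involution (x₀, x₁, x₂, x₃) ↦ (x₃/ξ, x₂, x₁,
-- ξx₀); they are complementary because 2 ≠ 0. The factor 2 in `B` is what puts the set into these
-- coordinates: B(H(a)) = 2a - (a - a′) = a + a′. The map u ↦ bσ(u) is σ-semilinear, so the
-- geometric part is carried out for an abstract endomorphism σ whose fixed elements are exactly
-- those of F_q; for x ↦ x^(q^r) this is Bézout's identity applied to n and r. The lines meeting
-- three of the long lines fill a whole regulus, and for σ = id every one of them would meet all the
-- lines joining P to σ(P), so a fourth long line, at a parameter moved by σ, is unavoidable. The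
-- obstacle on the algebraic side is that the field is given by its number of elements alone: the
-- characteristic, the additivity of Frobenius and the size of the fixed field must all be derived
-- from q^n, and independence and spanning over F_q are then handled by comparing cardinalities.

-- The solvers of the library cannot cancel x − x when the coefficients are
-- taken in an abstract ring, so they are taken here among the pairs (a , b) of
-- naturals, standing for the integers a − b.
module IntegerCoefficients (R : CommutativeRing 0ℓ 0ℓ) where
  open CommutativeRing R hiding (zero; refl; sym; trans; setoid) renaming (Carrier to K)
  open Algebra.Properties.Ring ring using (-‿distribˡ-*; -‿distribʳ-*; -‿involutive; -0#≈0#)
  open Algebra.Properties.AbelianGroup +-abelianGroup using (⁻¹-∙-comm)
  open Algebra.Properties.Semiring.Mult semiring
    using (×-homo-+; ×1-homo-*) renaming (_×_ to _·_)
  open Algebra.Properties.Semiring.Mult.TCOptimised semiring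
    using () renaming (_×_ to _·′_; ×ᵤ≈× to ·≈·′)
  open Algebra.Solver.Ring.NaturalCoefficients.Default commutativeSemiring
    using (solve; _:+_; _:*_; _:=_)
  open import Relation.Binary.Reasoning.Setoid (CommutativeRing.setoid R)
  module ≈ = CommutativeRing R

  -- Normal form of a pair: once common units are cancelled, equal integers are equal pairs, which
  -- is what lets `_≟_` compare coefficients.
  reduce : ℕ → ℕ → ℕ × ℕ
  reduce (suc a) (suc b) = reduce a b
  reduce a       b       = a , b

  coefficients : RawRing 0ℓ 0ℓ
  coefficients = record
    { Carrier = ℕ × ℕ
    ; _≈_ = _≡_
    ; _+_ = λ (a , b) (c , d) → reduce (a ℕ.+ c) (b ℕ.+ d)
    ; _*_ = λ (a , b) (c , d) → reduce (a ℕ.* c ℕ.+ b ℕ.* d) (a ℕ.* d ℕ.+ b ℕ.* c)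
    ; -_ = λ (a , b) → b , a
    ; 0# = 0 , 0
    ; 1# = 1 , 0
    }

  -- The first clause makes the value of (1 , 0) definitionally equal to 1#.
  ⟦_⟧ : ℕ × ℕ → K
  ⟦ a , zero  ⟧ = a ·′ 1#
  ⟦ a , suc b ⟧ = a · 1# + - (suc b · 1#)

  ⟦⟧-difference : ∀ a b → ⟦ a , b ⟧ ≈ a · 1# + - (b · 1#)
  ⟦⟧-difference a zero = begin
    a ·′ 1#           ≈⟨ ·≈·′ a 1# ⟨
    a · 1#            ≈⟨ +-identityʳ _ ⟨
    a · 1# + 0#       ≈⟨ +-congˡ -0#≈0# ⟨
    a · 1# + - 0#     ∎
  ⟦⟧-difference a (suc b) = ≈.refl

  +-difference : ∀ a b c d → (a + c) + - (b + d) ≈ (a + - b) + (c + - d)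
  +-difference a b c d = begin
    (a + c) + - (b + d)     ≈⟨ +-congˡ (⁻¹-∙-comm b d) ⟨
    (a + c) + (- b + - d)   ≈⟨ solve 4 (λ a b c d → (a :+ c) :+ (b :+ d) := (a :+ b) :+ (c :+ d)) ≈.refl a (- b) c (- d) ⟩
    (a + - b) + (c + - d)   ∎

  ⟦reduce⟧ : ∀ a b → ⟦ reduce a b ⟧ ≈ a · 1# + - (b · 1#)
  ⟦reduce⟧ zero    b       = ⟦⟧-difference zero b
  ⟦reduce⟧ (suc a) zero    = ⟦⟧-difference (suc a) zero
  ⟦reduce⟧ (suc a) (suc b) = begin
    ⟦ reduce a b ⟧                        ≈⟨ ⟦reduce⟧ a b ⟩
    a · 1# + - (b · 1#)                   ≈⟨ +-identityˡ _ ⟨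
    0# + (a · 1# + - (b · 1#))            ≈⟨ +-congʳ (-‿inverseʳ 1#) ⟨
    (1# + - 1#) + (a · 1# + - (b · 1#))   ≈⟨ +-difference _ _ _ _ ⟨
    (1# + a · 1#) + - (1# + b · 1#)       ∎

  *-difference : ∀ a b c d → (a * c + b * d) + - (a * d + b * c) ≈ (a + - b) * (c + - d)
  *-difference a b c d = begin
    (a * c + b * d) + - (a * d + b * c)
      ≈⟨ +-cong (+-congˡ b*d) (≈.trans (≈.sym (⁻¹-∙-comm _ _)) (+-cong (-‿distribʳ-* a d) (-‿distribˡ-* b c))) ⟩
    (a * c + - b * - d) + (a * - d + - b * c)
      ≈⟨ solve 4 (λ a b c d → (a :* c :+ b :* d) :+ (a :* d :+ b :* c) := (a :+ b) :* (c :+ d)) ≈.refl a (- b) c (- d) ⟩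
    (a + - b) * (c + - d) ∎
    where
    b*d : b * d ≈ - b * - d
    b*d = begin
      b * d        ≈⟨ -‿involutive _ ⟨
      - - (b * d)  ≈⟨ -‿cong (-‿distribˡ-* b d) ⟩
      - (- b * d)  ≈⟨ -‿distribʳ-* (- b) d ⟩
      - b * - d    ∎

  almostCommutativeRing : AlmostCommutativeRing 0ℓ 0ℓ
  almostCommutativeRing = fromCommutativeRing R

  morphism : coefficients -Raw-AlmostCommutative⟶ almostCommutativeRing
  morphism = record
    { ⟦_⟧ = ⟦_⟧
    ; +-homo = λ (a , b) (c , d) → begin
        ⟦ reduce (a ℕ.+ c) (b ℕ.+ d) ⟧                 ≈⟨ ⟦reduce⟧ (a ℕ.+ c) (b ℕ.+ d) ⟩
        (a ℕ.+ c) · 1# + - ((b ℕ.+ d) · 1#)            ≈⟨ +-cong (×-homo-+ 1# a c) (-‿cong (×-homo-+ 1# b d)) ⟩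
        (a · 1# + c · 1#) + - (b · 1# + d · 1#)        ≈⟨ +-difference _ _ _ _ ⟩
        (a · 1# + - (b · 1#)) + (c · 1# + - (d · 1#))  ≈⟨ +-cong (⟦⟧-difference a b) (⟦⟧-difference c d) ⟨
        ⟦ a , b ⟧ + ⟦ c , d ⟧                          ∎
    ; *-homo = λ (a , b) (c , d) → begin
        ⟦ reduce (a ℕ.* c ℕ.+ b ℕ.* d) (a ℕ.* d ℕ.+ b ℕ.* c) ⟧
          ≈⟨ ⟦reduce⟧ (a ℕ.* c ℕ.+ b ℕ.* d) (a ℕ.* d ℕ.+ b ℕ.* c) ⟩
        (a ℕ.* c ℕ.+ b ℕ.* d) · 1# + - ((a ℕ.* d ℕ.+ b ℕ.* c) · 1#)
          ≈⟨ +-cong (sum-of-products a c b d) (-‿cong (sum-of-products a d b c)) ⟩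
        (a · 1# * c · 1# + b · 1# * d · 1#) + - (a · 1# * d · 1# + b · 1# * c · 1#)
          ≈⟨ *-difference _ _ _ _ ⟩
        (a · 1# + - (b · 1#)) * (c · 1# + - (d · 1#))
          ≈⟨ *-cong (⟦⟧-difference a b) (⟦⟧-difference c d) ⟨
        ⟦ a , b ⟧ * ⟦ c , d ⟧ ∎
    ; -‿homo = λ (a , b) → begin
        ⟦ b , a ⟧                    ≈⟨ ⟦⟧-difference b a ⟩
        b · 1# + - (a · 1#)          ≈⟨ +-comm _ _ ⟩
        - (a · 1#) + b · 1#          ≈⟨ +-congˡ (-‿involutive _) ⟨
        - (a · 1#) + - - (b · 1#)    ≈⟨ ⁻¹-∙-comm _ _ ⟩
        - (a · 1# + - (b · 1#))      ≈⟨ -‿cong (⟦⟧-difference a b) ⟨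
        - ⟦ a , b ⟧                  ∎
    ; 0-homo = ≈.refl
    ; 1-homo = ≈.refl
    }
    where
    sum-of-products : ∀ a b c d → (a ℕ.* b ℕ.+ c ℕ.* d) · 1# ≈ a · 1# * b · 1# + c · 1# * d · 1#
    sum-of-products a b c d =
      ≈.trans (×-homo-+ 1# (a ℕ.* b) (c ℕ.* d)) (+-cong (×1-homo-* a b) (×1-homo-* c d))

  _≟_ : ∀ x y → Maybe (⟦ x ⟧ ≈ ⟦ y ⟧)
  x ≟ y = Maybe.map (λ { refl → ≈.refl }) (dec⇒maybe (≡-dec ℕ._≟_ ℕ._≟_ x y))

  open Algebra.Solver.Ring coefficients almostCommutativeRing morphism _≟_ public
    using (Polynomial; solve; con; _:+_; _:*_; _:-_; :-_; _:=_)

  :1 : ∀ {n} → Polynomial n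
  :1 = con (1 , 0)

  :0 : ∀ {n} → Polynomial n
  :0 = con (0 , 0)

-- Divisibility of binomial coefficients by a prime

prime∤! : ∀ {p} → Prime p → ∀ m → m ℕ.< p → ¬ (p ∣ m !)
prime∤! pr zero _ p∣1 = ℕ.<⇒≱ (ℕ.nonTrivial⇒n>1 _ {{prime⇒nonTrivial pr}}) (∣⇒≤ p∣1)
prime∤! pr (suc m) m<p p∣m! with euclidsLemma (suc m) (m !) pr p∣m!
... | inj₁ p∣1+m = ℕ.<⇒≱ m<p (∣⇒≤ p∣1+m)
... | inj₂ p∣m!' = prime∤! pr m (ℕ.<-trans (ℕ.n<1+n m) m<p) p∣m!'

-- The prime p divides p! = C(p,k) · k! (p - k)!, but neither of the two factorials, whose factors
-- are all below p.
prime∣C : ∀ {p} → Prime p → ∀ k → 0 ℕ.< k → k ℕ.< p → p ∣ p C k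
prime∣C {p} pr k 0<k k<p with euclidsLemma (p C k) (k ! ℕ.* (p ℕ.∸ k) !) pr p∣product
  where
  instance
    k!*[p∸k]!≢0 : NonZero (k ! ℕ.* (p ℕ.∸ k) !)
    k!*[p∸k]!≢0 = ℕ._!*_!≢0 k (p ℕ.∸ k)
  p! : (p C k) ℕ.* (k ! ℕ.* (p ℕ.∸ k) !) ≡ p !
  p! = trans (cong (ℕ._* (k ! ℕ.* (p ℕ.∸ k) !)) (nCk≡n!/k![n-k]! (ℕ.<⇒≤ k<p)))
             (m/n*n≡m (k![n∸k]!∣n! (ℕ.<⇒≤ k<p)))
  p∣p! : ∀ {m} → .{{NonZero m}} → m ∣ m !
  p∣p! {suc m} = m∣m*n (m !)
  p∣product : p ∣ (p C k) ℕ.* (k ! ℕ.* (p ℕ.∸ k) !)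
  p∣product = subst (p ∣_) (sym p!) (p∣p! {{prime⇒nonZero pr}})
... | inj₁ p∣C = p∣C
... | inj₂ p∣k!*[p∸k]! with euclidsLemma (k !) ((p ℕ.∸ k) !) pr p∣k!*[p∸k]!
...   | inj₁ p∣k! = contradiction p∣k! (prime∤! pr k k<p)
...   | inj₂ p∣[p∸k]! = contradiction p∣[p∸k]! (prime∤! pr (p ℕ.∸ k) (ℕ.∸-monoʳ-< 0<k (ℕ.<⇒≤ k<p)))

-- Sums with at most one nontrivial term

module SumProperties (M : CommutativeMonoid 0ℓ 0ℓ) where
  open CommutativeMonoid M
  open Algebra.Properties.CommutativeMonoid.Sum M

  sum-ε : ∀ {m} (t : Fin m → Carrier) → (∀ i → t i ≈ ε) → sum t ≈ ε
  sum-ε {m} t t≈ε = CommutativeMonoid.trans M (sum-cong-≋ t≈ε) (sum-replicate-zero m)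

  sum-single : ∀ {m} (t : Fin m → Carrier) (i : Fin m) → (∀ j → j ≢ i → t j ≈ ε) → sum t ≈ t i
  sum-single {suc m} t i t≈ε = CommutativeMonoid.trans M (sum-remove {i = i} t)
    (CommutativeMonoid.trans M (∙-congˡ (sum-ε _ λ j → t≈ε _ (Fin.punchInᵢ≢i i j))) (identityʳ _))

-- Finite field arithmetic: cancellation, powers, characteristic

module FieldProperties (F : FiniteField) (q n : ℕ) where
  open Geom F q n

  commutativeRing : CommutativeRing 0ℓ 0ℓ
  commutativeRing = record { isCommutativeRing = isCommutativeRing }

  open CommutativeRing commutativeRing public
    using ( ring; semiring; commutativeSemiring; +-commutativeMonoid; *-commutativeMonoid; +-group
          ; +-assoc; +-comm; +-identityˡ; +-identityʳ; -‿inverseʳ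
          ; *-assoc; *-comm; *-identityˡ; *-identityʳ; zeroˡ; zeroʳ; distribˡ; distribʳ)
  open Algebra.Properties.Group +-group public using () renaming (x∙y⁻¹≈ε⇒x≈y to x-y≡0⇒x≡y)
  open IntegerCoefficients commutativeRing public
    using (solve; con; _:+_; _:*_; _:-_; :-_; _:=_; :0; :1)
  open Algebra.Properties.Semiring.Mult semiring public
    using () renaming (_×_ to _·_; ×1-homo-* to ·1-homo-*; ×-assoc-* to ·-assoc-*)
  private
    module Exp = Algebra.Properties.Semiring.Exp semiring
    module Sum = Algebra.Properties.CommutativeMonoid.Sum +-commutativeMonoid
    module Product = Algebra.Properties.CommutativeMonoid.Sum *-commutativeMonoid

  open ≡-Reasoning

  x*y≡0⇒y≡0 : ∀ {x y} → x ≢ 0# → x * y ≡ 0# → y ≡ 0#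
  x*y≡0⇒y≡0 {x} {y} x≢0 x*y≡0 = begin
    y
      ≡⟨ solve 3 (λ x y z → y := (:1 :- x :* z) :* y :+ z :* (x :* y)) refl x y (proj₁ (inverse x x≢0)) ⟩
    (1# - x * proj₁ (inverse x x≢0)) * y + proj₁ (inverse x x≢0) * (x * y)
                      ≡⟨ cong₂ (λ u v → (1# - u) * y + proj₁ (inverse x x≢0) * v) (proj₂ (inverse x x≢0)) x*y≡0 ⟩
    (1# - 1#) * y + proj₁ (inverse x x≢0) * 0#
                      ≡⟨ solve 2 (λ y z → (:1 :- :1) :* y :+ z :* :0 := :0) refl y (proj₁ (inverse x x≢0)) ⟩
    0#                ∎

  x*y≢0 : ∀ {x y} → x ≢ 0# → y ≢ 0# → x * y ≢ 0#
  x*y≢0 x≢0 y≢0 x*y≡0 = y≢0 (x*y≡0⇒y≡0 x≢0 x*y≡0)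

  *-cancelˡ : ∀ {x y z} → x ≢ 0# → x * y ≡ x * z → y ≡ z
  *-cancelˡ {x} {y} {z} x≢0 x*y≡x*z = x-y≡0⇒x≡y y z (x*y≡0⇒y≡0 x≢0 (begin
    x * (y - z)     ≡⟨ solve 3 (λ x y z → x :* (y :- z) := x :* y :- x :* z) refl x y z ⟩
    x * y - x * z   ≡⟨ cong (_- x * z) x*y≡x*z ⟩
    x * z - x * z   ≡⟨ -‿inverseʳ (x * z) ⟩
    0#              ∎))

  ^-exp : ∀ x k → x ^ k ≡ x Exp.^ k
  ^-exp x zero    = refl
  ^-exp x (suc k) = cong (x *_) (^-exp x k)

  ^-homo-* : ∀ x j k → x ^ (j ℕ.+ k) ≡ x ^ j * x ^ k
  ^-homo-* x j k rewrite ^-exp x (j ℕ.+ k) | ^-exp x j | ^-exp x k = Exp.^-homo-* x j k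

  ^-assocʳ : ∀ x j k → (x ^ j) ^ k ≡ x ^ (j ℕ.* k)
  ^-assocʳ x j k rewrite ^-exp (x ^ j) k | ^-exp x (j ℕ.* k) | ^-exp x j = Exp.^-assocʳ x j k

  ^-distrib-* : ∀ x y k → (x * y) ^ k ≡ x ^ k * y ^ k
  ^-distrib-* x y k rewrite ^-exp (x * y) k | ^-exp x k | ^-exp y k =
    Algebra.Properties.CommutativeSemiring.Exp.^-distrib-* commutativeSemiring x y k

  1^ : ∀ k → 1# ^ k ≡ 1#
  1^ zero    = refl
  1^ (suc k) = trans (*-identityˡ _) (1^ k)

  x^k≢0 : ∀ {x} → x ≢ 0# → ∀ k → x ^ k ≢ 0#
  x^k≢0 x≢0 zero    1≡0 = 0≢1 (sym 1≡0)
  x^k≢0 x≢0 (suc k)     = x*y≢0 x≢0 (x^k≢0 x≢0 k)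

  element : Fin size → K
  element = Inverse.to enum

  index : K → Fin size
  index = Inverse.from enum

  element-index : ∀ x → element (index x) ≡ x
  element-index = Inverse.strictlyInverseˡ enum

  index-element : ∀ i → index (element i) ≡ i
  index-element = Inverse.strictlyInverseʳ enum

  element-injective : ∀ {i j} → element i ≡ element j → i ≡ j
  element-injective {i} {j} eq = trans (sym (index-element i)) (trans (cong index eq) (index-element j))

  index-injective : ∀ {x y} → index x ≡ index y → x ≡ y
  index-injective {x} {y} eq = trans (sym (element-index x)) (trans (cong element eq) (element-index y))

  infix 4 _≟_
  _≟_ : DecidableEquality K
  x ≟ y = map′ index-injective (cong index) (index x Fin.≟ index y)

  -- Translation by 1 permutes the field, so the sum S of all elements satisfies S = S + size · 1.
  size·1≡0 : size · 1# ≡ 0#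
  size·1≡0 = begin
    size · 1#
      ≡⟨ solve 2 (λ a s → a := (s :+ a) :- s) refl (size · 1#) (Sum.sum element) ⟩
    (Sum.sum element + size · 1#) - Sum.sum element ≡⟨ cong (_- Sum.sum element) shift ⟨
    Sum.sum element - Sum.sum element       ≡⟨ -‿inverseʳ _ ⟩
    0#                                      ∎
    where
    translation = permutation (λ i → index (element i + 1#)) (λ i → index (element i - 1#))
      (λ i → trans (cong index (trans (cong (_+ 1#) (element-index _)) (solve 1 (λ x → (x :- :1) :+ :1 := x) refl (element i))))
                   (index-element i))
      (λ i → trans (cong index (trans (cong (_- 1#) (element-index _)) (solve 1 (λ x → (x :+ :1) :- :1 := x) refl (element i))))
                   (index-element i))
    shift : Sum.sum element ≡ Sum.sum element + size · 1#
    shift = begin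
      Sum.sum element                                         ≡⟨ Sum.sum-permute element translation ⟩
      Sum.sum (λ i → element (index (element i + 1#)))
        ≡⟨ Sum.sum-cong-≗ (λ i → element-index (element i + 1#)) ⟩
      Sum.sum (λ i → element i + 1#)                          ≡⟨ Sum.∑-distrib-+ element (λ _ → 1#) ⟩
      Sum.sum element + Sum.sum {size} (λ _ → 1#)             ≡⟨ cong (Sum.sum element +_) (Sum.sum-replicate size) ⟩
      Sum.sum element + size · 1#                             ∎

  product≢0 : ∀ {m} (t : Fin m → K) → (∀ i → t i ≢ 0#) → Product.sum t ≢ 0#
  product≢0 {zero}  t t≢0 1≡0 = 0≢1 (sym 1≡0)
  product≢0 {suc m} t t≢0     = x*y≢0 (t≢0 zero) (product≢0 (t ∘ suc) (t≢0 ∘ suc))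

  -- Multiplication by x permutes the nonzero elements, so their product P
  -- satisfies P = x^(size - 1) P; the factor for 0 is set to 1 throughout.
  x^size≡x : ∀ x → x ≢ 0# → x ^ size ≡ x
  x^size≡x x x≢0 = begin
    x ^ size                                            ≡⟨ ^-exp x size ⟩
    x Exp.^ size                                        ≡⟨ Product.sum-replicate size ⟨
    Product.sum {size} (λ _ → x)                        ≡⟨ Product.sum-cong-≗ (λ i → split (element i)) ⟩
    Product.sum (λ i → off0 x (element i) * at0 x (element i))
                                                        ≡⟨ Product.∑-distrib-+ (off0 x ∘ element) (at0 x ∘ element) ⟩
    Product.sum (off0 x ∘ element) * Product.sum (at0 x ∘ element)
                                                        ≡⟨ cong₂ _*_ off0-product at0-product ⟩
    1# * x                                              ≡⟨ *-identityˡ x ⟩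
    x                                                   ∎
    where
    -- Each of the `size` factors x is written as a product of two: `off0` carries it at the nonzero
    -- elements and `at0` at 0. The first product is then 1 and the second is a single x.
    off0 at0 : K → K → K
    off0 z y with y ≟ 0#
    ... | yes _ = 1#
    ... | no  _ = z
    at0 z y with y ≟ 0#
    ... | yes _ = z
    ... | no  _ = 1#

    split : ∀ y → x ≡ off0 x y * at0 x y
    split y with y ≟ 0#
    ... | yes _ = sym (*-identityˡ x)
    ... | no  _ = sym (*-identityʳ x)

    at0-product : Product.sum (at0 x ∘ element) ≡ x
    at0-product = trans (SumProperties.sum-single *-commutativeMonoid (at0 x ∘ element) (index 0#) off)
                        (trans (cong (at0 x) (element-index 0#)) at)
      where
      at : at0 x 0# ≡ x
      at with 0# ≟ 0#
      ... | yes _  = refl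
      ... | no 0≢0 = contradiction refl 0≢0
      off : ∀ j → j ≢ index 0# → at0 x (element j) ≡ 1#
      off j j≢ with element j ≟ 0#
      ... | yes eq = contradiction (trans (sym (index-element j)) (cong index eq)) j≢
      ... | no  _  = refl

    nonzero : K → K
    nonzero y = off0 y y

    nonzero≢0 : ∀ y → nonzero y ≢ 0#
    nonzero≢0 y with y ≟ 0#
    ... | yes _  = λ 1≡0 → 0≢1 (sym 1≡0)
    ... | no y≢0 = y≢0

    nonzero-* : ∀ y → nonzero (x * y) ≡ off0 x y * nonzero y
    nonzero-* y with y ≟ 0# | x * y ≟ 0#
    ... | yes _   | yes _     = sym (*-identityˡ 1#)
    ... | yes y≡0 | no x*y≢0  = contradiction (trans (cong (x *_) y≡0) (zeroʳ x)) x*y≢0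
    ... | no y≢0  | yes x*y≡0 = contradiction (x*y≡0⇒y≡0 x≢0 x*y≡0) y≢0
    ... | no _    | no _      = refl

    x⁻¹ = proj₁ (inverse x x≢0)
    x*x⁻¹≡1 = proj₂ (inverse x x≢0)

    dilation = permutation (λ i → index (x * element i)) (λ i → index (x⁻¹ * element i))
      (λ i → trans (cong index (begin
        x * element (index (x⁻¹ * element i)) ≡⟨ cong (x *_) (element-index _) ⟩
        x * (x⁻¹ * element i)                 ≡⟨ *-assoc _ _ _ ⟨
        x * x⁻¹ * element i                   ≡⟨ cong (_* element i) x*x⁻¹≡1 ⟩
        1# * element i                        ≡⟨ *-identityˡ _ ⟩
        element i                             ∎)) (index-element i))
      (λ i → trans (cong index (begin
        x⁻¹ * element (index (x * element i)) ≡⟨ cong (x⁻¹ *_) (element-index _) ⟩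
        x⁻¹ * (x * element i)                 ≡⟨ *-assoc _ _ _ ⟨
        x⁻¹ * x * element i                   ≡⟨ cong (_* element i) (trans (*-comm _ _) x*x⁻¹≡1) ⟩
        1# * element i                        ≡⟨ *-identityˡ _ ⟩
        element i                             ∎)) (index-element i))

    P = Product.sum (nonzero ∘ element)

    off0-product : Product.sum (off0 x ∘ element) ≡ 1#
    off0-product = *-cancelˡ (product≢0 (nonzero ∘ element) (nonzero≢0 ∘ element)) (begin
      P * Product.sum (off0 x ∘ element)                         ≡⟨ *-comm _ _ ⟩
      Product.sum (off0 x ∘ element) * P
        ≡⟨ Product.∑-distrib-+ (off0 x ∘ element) (nonzero ∘ element) ⟨
      Product.sum (λ i → off0 x (element i) * nonzero (element i))
        ≡⟨ Product.sum-cong-≗ (λ i → nonzero-* (element i)) ⟨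
      Product.sum (λ i → nonzero (x * element i))
        ≡⟨ Product.sum-cong-≗ (λ i → cong nonzero (element-index (x * element i))) ⟨
      Product.sum (λ i → nonzero (element (index (x * element i))))
        ≡⟨ Product.sum-permute (nonzero ∘ element) dilation ⟨
      P                                                          ≡⟨ *-identityʳ P ⟨
      P * 1#                                                     ∎)

  module _ {p : ℕ} (pr : Prime p) (p·1≡0 : p · 1# ≡ 0#) where
    open Algebra.Properties.CommutativeSemiring.Binomial commutativeSemiring
      using (binomialTerm) renaming (theorem to binomial-theorem)

    p∣m⇒m·x≡0 : ∀ {m} → p ∣ m → ∀ x → m · x ≡ 0#
    p∣m⇒m·x≡0 (divides k refl) x = begin
      (k ℕ.* p) · x            ≡⟨ cong ((k ℕ.* p) ·_) (*-identityˡ x) ⟨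
      (k ℕ.* p) · (1# * x)     ≡⟨ ·-assoc-* (k ℕ.* p) 1# x ⟨
      ((k ℕ.* p) · 1#) * x     ≡⟨ cong (_* x) (·1-homo-* k p) ⟩
      k · 1# * p · 1# * x      ≡⟨ cong (λ z → k · 1# * z * x) p·1≡0 ⟩
      k · 1# * 0# * x          ≡⟨ solve 2 (λ k x → k :* :0 :* x := :0) refl (k · 1#) x ⟩
      0#                       ∎

    -- In the binomial expansion all inner coefficients are multiples of p, hence vanish in
    -- characteristic p.
    [x+y]^p : ∀ x y → (x + y) ^ p ≡ x ^ p + y ^ p
    [x+y]^p x y = ends p pr refl
      where
      -- The exponent is a separate variable m equal to p, so that it can be matched as a successor
      -- and the two end terms split off.
      ends : ∀ m → Prime m → m ≡ p → (x + y) ^ m ≡ x ^ m + y ^ m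
      ends (suc m) prm m≡p = begin
        (x + y) ^ suc m      ≡⟨ ^-exp (x + y) (suc m) ⟩
        (x + y) Exp.^ suc m  ≡⟨ binomial-theorem (suc m) x y ⟩
        term zero + Sum.sum (term ∘ suc)
          ≡⟨ cong (term zero +_) (Sum.sum-init-last (term ∘ suc)) ⟩
        term zero + (Sum.sum (term ∘ suc ∘ inject₁) + term (suc (fromℕ m)))
          ≡⟨ cong (λ z → term zero + (z + term (suc (fromℕ m)))) (SumProperties.sum-ε +-commutativeMonoid _ middle) ⟩
        term zero + (0# + term (suc (fromℕ m)))
          ≡⟨ cong (λ z → term zero + (0# + z)) last-term ⟩
        term zero + (0# + x ^ suc m)
          ≡⟨ cong (_+ (0# + x ^ suc m)) first-term ⟩
        y ^ suc m + (0# + x ^ suc m)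
          ≡⟨ solve 2 (λ a b → b :+ (:0 :+ a) := a :+ b) refl (x ^ suc m) (y ^ suc m) ⟩
        x ^ suc m + y ^ suc m ∎
        where
        term : Fin (suc (suc m)) → K
        term = binomialTerm x y (suc m)
        middle : ∀ i → term (suc (inject₁ i)) ≡ 0#
        middle i = p∣m⇒m·x≡0 (subst (_∣ suc m C suc (toℕ (inject₁ i))) m≡p
          (prime∣C prm (suc (toℕ (inject₁ i))) (ℕ.s≤s ℕ.z≤n)
            (ℕ.s≤s (subst (ℕ._< m) (sym (Fin.toℕ-inject₁ i)) (Fin.toℕ<n i))))) _
        first-term : term zero ≡ y ^ suc m
        first-term = trans (+-identityʳ _) (trans (*-identityˡ _) (sym (^-exp y (suc m))))
        last-term : term (suc (fromℕ m)) ≡ x ^ suc m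
        last-term = begin
          term (suc (fromℕ m))
            ≡⟨ cong (λ j → (suc m C j) · (x Exp.^ j * y Exp.^ (suc m ℕ.∸ j))) (Fin.toℕ-fromℕ (suc m)) ⟩
          (suc m C suc m) · (x Exp.^ suc m * y Exp.^ (m ℕ.∸ m))
            ≡⟨ cong₂ (λ c j → c · (x Exp.^ suc m * y Exp.^ j)) (nCn≡1 (suc m)) (ℕ.n∸n≡0 m) ⟩
          1 · (x Exp.^ suc m * 1#)
            ≡⟨ trans (+-identityʳ _) (*-identityʳ _) ⟩
          x Exp.^ suc m
            ≡⟨ ^-exp x (suc m) ⟨
          x ^ suc m ∎

    [x+y]^[p^e] : ∀ e x y → (x + y) ^ (p ℕ.^ e) ≡ x ^ (p ℕ.^ e) + y ^ (p ℕ.^ e)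
    [x+y]^[p^e] zero    x y = solve 2 (λ x y → (x :+ y) :* :1 := x :* :1 :+ y :* :1) refl x y
    [x+y]^[p^e] (suc e) x y = begin
      (x + y) ^ (p ℕ.* p ℕ.^ e)                        ≡⟨ ^-assocʳ (x + y) p (p ℕ.^ e) ⟨
      ((x + y) ^ p) ^ (p ℕ.^ e)                        ≡⟨ cong (_^ (p ℕ.^ e)) ([x+y]^p x y) ⟩
      (x ^ p + y ^ p) ^ (p ℕ.^ e)                      ≡⟨ [x+y]^[p^e] e (x ^ p) (y ^ p) ⟩
      (x ^ p) ^ (p ℕ.^ e) + (y ^ p) ^ (p ℕ.^ e)
        ≡⟨ cong₂ _+_ (^-assocʳ x p (p ℕ.^ e)) (^-assocʳ y p (p ℕ.^ e)) ⟩
      x ^ (p ℕ.* p ℕ.^ e) + y ^ (p ℕ.* p ℕ.^ e)        ∎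

-- Lists without repetition and filtering

module _ {A : Set} where

  lookup-injective : ∀ {xs : List A} → Unique xs → ∀ {i j} → List.lookup xs i ≡ List.lookup xs j → i ≡ j
  lookup-injective {_ ∷ xs} (_   ∷ u) {zero}  {zero}  eq = refl
  lookup-injective {_ ∷ xs} (x∉  ∷ u) {zero}  {suc j} eq = contradiction eq (ListAll.lookup x∉ (∈-lookup j))
  lookup-injective {_ ∷ xs} (x∉  ∷ u) {suc i} {zero}  eq = contradiction (sym eq) (ListAll.lookup x∉ (∈-lookup i))
  lookup-injective {_ ∷ xs} (_   ∷ u) {suc i} {suc j} eq = cong suc (lookup-injective u eq)

  length-filter-∁ : ∀ {P : A → Set} (P? : Decidable P) xs →
                    length (filter P? xs) ℕ.+ length (filter (∁? P?) xs) ≡ length xs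
  length-filter-∁ P? []       = refl
  length-filter-∁ P? (x ∷ xs) with P? x
  ... | yes _ = cong suc (length-filter-∁ P? xs)
  ... | no  _ = trans (ℕ.+-suc _ _) (cong suc (length-filter-∁ P? xs))

-- Numbers of roots and geometric sums

module Polynomials (F : FiniteField) (q n : ℕ) where
  open Geom F q n
  open FieldProperties F q n
  open ≡-Reasoning

  -- The leading coefficient 1 is not stored.
  evalMonic : ∀ {d} → Vec K d → K → K
  evalMonic []       x = 1#
  evalMonic (c ∷ cs) x = c + x * evalMonic cs x

  -- Synthetic division by X - a: the coefficients of the quotient are the values at a produced by
  -- Horner's scheme.
  quotient : ∀ {d} → K → Vec K (suc d) → Vec K d
  quotient a (c ∷ [])      = []
  quotient a (c ∷ d ∷ cs) = evalMonic (d ∷ cs) a ∷ quotient a (d ∷ cs)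

  remainder : ∀ {d} a (cs : Vec K (suc d)) x →
              evalMonic cs x ≡ (x - a) * evalMonic (quotient a cs) x + evalMonic cs a
  remainder a (c ∷ [])      x =
    solve 3 (λ a c x → c :+ x :* :1 := (x :- a) :* :1 :+ (c :+ a :* :1)) refl a c x
  remainder a (c ∷ d ∷ cs) x = begin
    c + x * E x                              ≡⟨ cong (λ z → c + x * z) (remainder a (d ∷ cs) x) ⟩
    c + x * ((x - a) * Q + E a)
      ≡⟨ solve 5 (λ a c x Q E → c :+ x :* ((x :- a) :* Q :+ E) := (x :- a) :* (E :+ x :* Q) :+ (c :+ a :* E)) refl a c x Q (E a) ⟩
    (x - a) * (E a + x * Q) + (c + a * E a)  ∎
    where
    E = evalMonic (d ∷ cs)
    Q = evalMonic (quotient a (d ∷ cs)) x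

  -- Once a root a is split off, each of the other roots x is a root of the quotient by X - a,
  -- because x - a ≠ 0.
  #roots≤degree : ∀ {d} (cs : Vec K d) {xs : List K} →
                  Unique xs → ListAll.All (λ x → evalMonic cs x ≡ 0#) xs → length xs ≤ d
  #roots≤degree cs       {[]}     []        []            = ℕ.z≤n
  #roots≤degree []       {a ∷ xs} (_ ∷ u)   (1≡0 ∷ _)     = contradiction (sym 1≡0) 0≢1
  #roots≤degree (c ∷ cs) {a ∷ xs} (a∉ ∷ u) (root-a ∷ roots) =
    ℕ.s≤s (#roots≤degree (quotient a (c ∷ cs)) u (ListAll.zipWith root-quotient (a∉ , roots)))
    where
    root-quotient : ∀ {x} → (a ≢ x) × (evalMonic (c ∷ cs) x ≡ 0#) → evalMonic (quotient a (c ∷ cs)) x ≡ 0#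
    root-quotient {x} (a≢x , root-x) = x*y≡0⇒y≡0 (λ x-a≡0 → a≢x (sym (x-y≡0⇒x≡y x a x-a≡0))) (begin
      (x - a) * Q            ≡⟨ solve 2 (λ m r → m := (m :+ r) :- r) refl ((x - a) * Q) (evalMonic (c ∷ cs) a) ⟩
      ((x - a) * Q + evalMonic (c ∷ cs) a) - evalMonic (c ∷ cs) a
                             ≡⟨ cong₂ _-_ (sym (remainder a (c ∷ cs) x)) root-a ⟩
      evalMonic (c ∷ cs) x - 0#  ≡⟨ cong (_- 0#) root-x ⟩
      0# - 0#                ≡⟨ -‿inverseʳ 0# ⟩
      0#                     ∎)
      where Q = evalMonic (quotient a (c ∷ cs)) x

  eval : ∀ {d} → Vec K d → K → K
  eval []       x = 0#
  eval (c ∷ cs) x = c + x * eval cs x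

  -- Describes the lower-order part of a monic polynomial. The coefficient vector may end in zeros,
  -- so a bound can be raised by padding and no coefficient has to be computed.
  DegreeBelow : ℕ → (K → K) → Set
  DegreeBelow d f = ∃ λ (cs : Vec K d) → ∀ x → f x ≡ eval cs x

  DegreeBelow-suc : ∀ {d f} → DegreeBelow d f → DegreeBelow (suc d) f
  DegreeBelow-suc (cs , f≡) = cs ∷ʳ 0# , λ x → trans (f≡ x) (eval-∷ʳ0 cs x)
    where
    eval-∷ʳ0 : ∀ {d} (cs : Vec K d) x → eval cs x ≡ eval (cs ∷ʳ 0#) x
    eval-∷ʳ0 []       x = solve 1 (λ x → :0 := :0 :+ x :* :0) refl x
    eval-∷ʳ0 (c ∷ cs) x = cong (λ z → c + x * z) (eval-∷ʳ0 cs x)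

  DegreeBelow-+ : ∀ {d f} k → DegreeBelow d f → DegreeBelow (k ℕ.+ d) f
  DegreeBelow-+ zero    f<d = f<d
  DegreeBelow-+ (suc k) f<d = DegreeBelow-suc (DegreeBelow-+ k f<d)

  DegreeBelow-monic : ∀ {d f} → DegreeBelow d f → DegreeBelow (suc d) (λ x → x ^ d + f x)
  DegreeBelow-monic {d} (cs , f≡) = cs ∷ʳ 1# , λ x → trans (cong (x ^ d +_) (f≡ x)) (eval-∷ʳ1 cs x)
    where
    eval-∷ʳ1 : ∀ {d} (cs : Vec K d) x → x ^ d + eval cs x ≡ eval (cs ∷ʳ 1#) x
    eval-∷ʳ1 []       x = solve 1 (λ x → :1 :+ :0 := :1 :+ x :* :0) refl x
    eval-∷ʳ1 {suc d} (c ∷ cs) x = trans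
      (solve 4 (λ c x p e → x :* p :+ (c :+ x :* e) := c :+ x :* (p :+ e)) refl c x (x ^ d) (eval cs x))
      (cong (λ z → c + x * z) (eval-∷ʳ1 cs x))

  #roots-monic≤degree : ∀ {d f} → DegreeBelow d f → ∀ {xs} →
                        Unique xs → ListAll.All (λ x → x ^ d + f x ≡ 0#) xs → length xs ≤ d
  #roots-monic≤degree {d} (cs , f≡) u roots =
    #roots≤degree cs u (ListAll.map (λ {x} root →
      trans (evalMonic≡ cs x) (trans (cong (x ^ d +_) (sym (f≡ x))) root)) roots)
    where
    evalMonic≡ : ∀ {d} (cs : Vec K d) x → evalMonic cs x ≡ x ^ d + eval cs x
    evalMonic≡ []       x = sym (+-identityʳ 1#)
    evalMonic≡ {suc d} (c ∷ cs) x = trans (cong (λ z → c + x * z) (evalMonic≡ cs x))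
      (solve 4 (λ c x p e → c :+ x :* (p :+ e) := x :* p :+ (c :+ x :* e)) refl c x (x ^ d) (eval cs x))

  -- The quotient (x^(mk) - 1) / (x^m - 1), that is, 1 + x^m + ... + x^(m(k - 1)).
  geometric : ℕ → ℕ → K → K
  geometric m zero    x = 0#
  geometric m (suc k) x = x ^ (m ℕ.* k) + geometric m k x

  geometric-degree : ∀ m k → DegreeBelow (suc m ℕ.* k) (geometric (suc m) k)
  geometric-degree m zero    = subst (λ d → DegreeBelow d (geometric (suc m) 0)) (sym (ℕ.*-zeroʳ (suc m))) ([] , λ _ → refl)
  geometric-degree m (suc k) = subst (λ d → DegreeBelow d (geometric (suc m) (suc k)))
    (trans (ℕ.+-suc m (suc m ℕ.* k)) (sym (ℕ.*-suc (suc m) k)))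
    -- The new leading power raises the bound by one; padding by m more completes the step of m + 1.
    (DegreeBelow-+ m (DegreeBelow-monic (geometric-degree m k)))

  geometric-sum : ∀ m k x → (x ^ m - 1#) * geometric m k x + 1# ≡ x ^ (m ℕ.* k)
  geometric-sum m zero    x rewrite ℕ.*-zeroʳ m = solve 1 (λ y → (y :- :1) :* :0 :+ :1 := :1) refl (x ^ m)
  geometric-sum m (suc k) x = begin
    (x ^ m - 1#) * (x ^ (m ℕ.* k) + geometric m k x) + 1#
      ≡⟨ solve 3 (λ y z g → (y :- :1) :* (z :+ g) :+ :1 := (y :* z :- z) :+ ((y :- :1) :* g :+ :1)) refl (x ^ m) (x ^ (m ℕ.* k)) (geometric m k x) ⟩
    (x ^ m * x ^ (m ℕ.* k) - x ^ (m ℕ.* k)) + ((x ^ m - 1#) * geometric m k x + 1#)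
      ≡⟨ cong ((x ^ m * x ^ (m ℕ.* k) - x ^ (m ℕ.* k)) +_) (geometric-sum m k x) ⟩
    (x ^ m * x ^ (m ℕ.* k) - x ^ (m ℕ.* k)) + x ^ (m ℕ.* k)
      ≡⟨ solve 2 (λ y z → (y :* z :- z) :+ z := y :* z) refl (x ^ m) (x ^ (m ℕ.* k)) ⟩
    x ^ m * x ^ (m ℕ.* k)       ≡⟨ ^-homo-* x m (m ℕ.* k) ⟨
    x ^ (m ℕ.+ m ℕ.* k)         ≡⟨ cong (x ^_) (ℕ.*-suc m k) ⟨
    x ^ (m ℕ.* suc k)           ∎

-- Frobenius powers and the size of the fixed field

module FrobeniusProperties (F : FiniteField) (q n : ℕ)
  (isPrimePower : IsPrimePower q) (0<n : 0 ℕ.< n) (size≡q^n : FiniteField.size F ≡ q ℕ.^ n) where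
  open Geom F q n
  open FieldProperties F q n
  open Polynomials F q n
  open ≡-Reasoning

  private
    p e : ℕ
    p = proj₁ isPrimePower
    e = proj₁ (proj₂ isPrimePower)
    p-prime : Prime p
    p-prime = proj₁ (proj₂ (proj₂ isPrimePower))
    0<e : 0 ℕ.< e
    0<e = proj₁ (proj₂ (proj₂ (proj₂ isPrimePower)))
    q≡p^e : q ≡ p ℕ.^ e
    q≡p^e = proj₂ (proj₂ (proj₂ (proj₂ isPrimePower)))

  1<q : 1 ℕ.< q
  1<q = subst (1 ℕ.<_) (sym q≡p^e) (ℕ.^-monoʳ-< p (ℕ.nonTrivial⇒n>1 p {{prime⇒nonTrivial p-prime}}) 0<e)

  instance
    q≢0 : NonZero q
    q≢0 = ℕ.>-nonZero (ℕ.<-trans (ℕ.n<1+n 0) 1<q)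

  [j^k]·1 : ∀ j k → (j ℕ.^ k) · 1# ≡ (j · 1#) ^ k
  [j^k]·1 j zero    = +-identityʳ 1#
  [j^k]·1 j (suc k) = trans (·1-homo-* j (j ℕ.^ k)) (cong (j · 1# *_) ([j^k]·1 j k))

  -- A field has no nilpotents. This descends from q^n · 1 = 0 to q · 1 = 0, and from q = p^e to p ·
  -- 1 = 0.
  [j^k]·1≡0⇒j·1≡0 : ∀ j k → (j ℕ.^ k) · 1# ≡ 0# → j · 1# ≡ 0#
  [j^k]·1≡0⇒j·1≡0 j k eq with j · 1# ≟ 0#
  ... | yes j·1≡0 = j·1≡0
  ... | no  j·1≢0 = contradiction (trans (sym ([j^k]·1 j k)) eq) (x^k≢0 j·1≢0 k)

  q·1≡0 : q · 1# ≡ 0#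
  q·1≡0 = [j^k]·1≡0⇒j·1≡0 q n (subst (λ m → m · 1# ≡ 0#) size≡q^n size·1≡0)

  p·1≡0 : p · 1# ≡ 0#
  p·1≡0 = [j^k]·1≡0⇒j·1≡0 p e (subst (λ m → m · 1# ≡ 0#) q≡p^e q·1≡0)

  0^[q^k] : ∀ k → 0# ^ (q ℕ.^ k) ≡ 0#
  0^[q^k] k = trans (cong (0# ^_) (sym (ℕ.suc-pred (q ℕ.^ k) {{ℕ.m^n≢0 q k}}))) (zeroˡ _)

  [x+y]^[q^k] : ∀ k x y → (x + y) ^ (q ℕ.^ k) ≡ x ^ (q ℕ.^ k) + y ^ (q ℕ.^ k)
  [x+y]^[q^k] k x y = subst (λ m → (x + y) ^ m ≡ x ^ m + y ^ m)
    (trans (sym (ℕ.^-*-assoc p e k)) (cong (ℕ._^ k) (sym q≡p^e)))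
    ([x+y]^[p^e] p-prime p·1≡0 (e ℕ.* k) x y)

  [-x]^[q^k] : ∀ k x → (- x) ^ (q ℕ.^ k) ≡ - (x ^ (q ℕ.^ k))
  [-x]^[q^k] k x = begin
    (- x) ^ m              ≡⟨ solve 2 (λ u v → v := (u :+ v) :- u) refl (x ^ m) ((- x) ^ m) ⟩
    (x ^ m + (- x) ^ m) - x ^ m ≡⟨ cong (_- x ^ m) (sym ([x+y]^[q^k] k x (- x))) ⟩
    (x + - x) ^ m - x ^ m  ≡⟨ cong (λ z → z ^ m - x ^ m) (-‿inverseʳ x) ⟩
    0# ^ m - x ^ m         ≡⟨ cong (_- x ^ m) (0^[q^k] k) ⟩
    0# - x ^ m             ≡⟨ +-identityˡ _ ⟩
    - (x ^ m)              ∎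
    where m = q ℕ.^ k

  x^[q^n]≡x : ∀ x → x ^ (q ℕ.^ n) ≡ x
  x^[q^n]≡x x with x ≟ 0#
  ... | yes refl = 0^[q^k] n
  ... | no x≢0   = subst (λ m → x ^ m ≡ x) size≡q^n (x^size≡x x x≢0)

  InFq⇒x^[q^k]≡x : ∀ {x} → InFq x → ∀ k → x ^ (q ℕ.^ k) ≡ x
  InFq⇒x^[q^k]≡x {x} x∈Fq zero    = *-identityʳ x
  InFq⇒x^[q^k]≡x {x} x∈Fq (suc k) = begin
    x ^ (q ℕ.* q ℕ.^ k)      ≡⟨ ^-assocʳ x q (q ℕ.^ k) ⟨
    (x ^ q) ^ (q ℕ.^ k)      ≡⟨ cong (_^ (q ℕ.^ k)) x∈Fq ⟩
    x ^ (q ℕ.^ k)            ≡⟨ InFq⇒x^[q^k]≡x x∈Fq k ⟩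
    x                        ∎

  [x+y]^q : ∀ x y → (x + y) ^ q ≡ x ^ q + y ^ q
  [x+y]^q x y = subst (λ m → (x + y) ^ m ≡ x ^ m + y ^ m) (ℕ.*-identityʳ q) ([x+y]^[q^k] 1 x y)

  [-x]^q : ∀ x → (- x) ^ q ≡ - (x ^ q)
  [-x]^q x = subst (λ m → (- x) ^ m ≡ - (x ^ m)) (ℕ.*-identityʳ q) ([-x]^[q^k] 1 x)

  InFq-0 : InFq 0#
  InFq-0 = subst (λ m → 0# ^ m ≡ 0#) (ℕ.*-identityʳ q) (0^[q^k] 1)

  InFq-1 : InFq 1#
  InFq-1 = 1^ q

  InFq-+ : ∀ {x y} → InFq x → InFq y → InFq (x + y)
  InFq-+ {x} {y} x∈ y∈ = trans ([x+y]^q x y) (cong₂ _+_ x∈ y∈)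

  InFq-neg : ∀ {x} → InFq x → InFq (- x)
  InFq-neg {x} x∈ = trans ([-x]^q x) (cong (λ z → - z) x∈)

  InFq-* : ∀ {x y} → InFq x → InFq y → InFq (x * y)
  InFq-* {x} {y} x∈ y∈ = trans (^-distrib-* x y q) (cong₂ _*_ x∈ y∈)

  InFq-inverse : ∀ {x y} → x ≢ 0# → InFq x → x * y ≡ 1# → InFq y
  InFq-inverse {x} {y} x≢0 x∈ x*y≡1 = *-cancelˡ x≢0 (begin
    x * y ^ q        ≡⟨ cong (_* y ^ q) x∈ ⟨
    x ^ q * y ^ q    ≡⟨ ^-distrib-* x y q ⟨
    (x * y) ^ q      ≡⟨ cong (_^ q) x*y≡1 ⟩
    1# ^ q           ≡⟨ 1^ q ⟩
    1#               ≡⟨ x*y≡1 ⟨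
    x * y            ∎)

  elements fixed unfixed : List K
  elements = tabulate element
  InFq? : Decidable InFq
  InFq? x = x ^ q ≟ x
  fixed    = filter InFq? elements
  unfixed  = filter (∁? InFq?) elements

  elements-unique : Unique elements
  elements-unique = tabulate⁺ element-injective

  -- Writing q as m + 2 makes q - 1 the successor `suc m`, the form of exponent required by
  -- `geometric-degree`.
  module _ (m : ℕ) (q≡2+m : q ≡ suc (suc m)) where

    fixed≤q : length fixed ≤ q
    fixed≤q = subst (length fixed ≤_) (sym q≡2+m) (#roots-monic≤degree
      -- The lower part of x^q - x is 0 + (-1)x, of degree below 2; padding by m brings the bound to
      -- q.
      (subst (λ d → DegreeBelow d (λ x → - x)) (ℕ.+-comm m 2)
        (DegreeBelow-+ m ((0# ∷ - 1# ∷ []) , λ x → solve 1 (λ x → :- x := :0 :+ x :* (:- :1 :+ x :* :0)) refl x)))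
      (filter⁺ InFq? elements-unique)
      (ListAll.map (λ {x} x∈ → trans (cong (_- x) (trans (cong (x ^_) (sym q≡2+m)) x∈)) (-‿inverseʳ x))
        (all-filter InFq? elements)))

    q^j≡1+[q-1]*normExp : ∀ j → q ℕ.^ j ≡ suc (suc m ℕ.* normExp j)
    q^j≡1+[q-1]*normExp zero    = cong suc (sym (ℕ.*-zeroʳ (suc m)))
    q^j≡1+[q-1]*normExp (suc j) = begin
      q ℕ.* q ℕ.^ j                               ≡⟨ cong (ℕ._* q ℕ.^ j) q≡2+m ⟩
      q ℕ.^ j ℕ.+ suc m ℕ.* q ℕ.^ j               ≡⟨ cong (ℕ._+ suc m ℕ.* q ℕ.^ j) (q^j≡1+[q-1]*normExp j) ⟩
      suc (suc m ℕ.* normExp j ℕ.+ suc m ℕ.* q ℕ.^ j)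
        ≡⟨ cong suc (trans (sym (ℕ.*-distribˡ-+ (suc m) (normExp j) (q ℕ.^ j))) (cong (suc m ℕ.*_) (ℕ.+-comm (normExp j) _))) ⟩
      suc (suc m ℕ.* (q ℕ.^ j ℕ.+ normExp j))     ∎

    -- For x ∉ F_q, the identity x^(q^n - 1) - 1 = (x^(q - 1) - 1)(1 + x^(q - 1) + …)
    -- makes x a root of the second factor, which has degree q^n - q.
    unfixed≤ : ∀ k → normExp n ≡ suc k → length unfixed ≤ suc m ℕ.* k
    unfixed≤ k N≡1+k = #roots-monic≤degree (geometric-degree m k)
      (filter⁺ (∁? InFq?) elements-unique)
      (ListAll.map root (all-filter (∁? InFq?) elements))
      where
      root : ∀ {x} → ¬ InFq x → geometric (suc m) (suc k) x ≡ 0#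
      root {x} x∉ = x*y≡0⇒y≡0 x^[q-1]-1≢0 (begin
        (x ^ suc m - 1#) * S              ≡⟨ solve 1 (λ z → z := (z :+ :1) :- :1) refl ((x ^ suc m - 1#) * S) ⟩
        ((x ^ suc m - 1#) * S + 1#) - 1#  ≡⟨ cong (_- 1#) (geometric-sum (suc m) (suc k) x) ⟩
        x ^ (suc m ℕ.* suc k) - 1#        ≡⟨ cong (_- 1#) x^[q^n-1]≡1 ⟩
        1# - 1#                           ≡⟨ -‿inverseʳ 1# ⟩
        0#                                ∎)
        where
        S = geometric (suc m) (suc k) x
        x≢0 : x ≢ 0#
        x≢0 refl = x∉ InFq-0
        x^[q-1]-1≢0 : x ^ suc m - 1# ≢ 0#
        x^[q-1]-1≢0 eq = x∉ (trans (cong (x ^_) q≡2+m) (trans (cong (x *_) (x-y≡0⇒x≡y _ _ eq)) (*-identityʳ x)))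
        x^[q^n-1]≡1 : x ^ (suc m ℕ.* suc k) ≡ 1#
        x^[q^n-1]≡1 = *-cancelˡ x≢0 (begin
          x ^ suc (suc m ℕ.* suc k)      ≡⟨ cong (λ j → x ^ suc (suc m ℕ.* j)) N≡1+k ⟨
          x ^ suc (suc m ℕ.* normExp n)  ≡⟨ cong (x ^_) (q^j≡1+[q-1]*normExp n) ⟨
          x ^ (q ℕ.^ n)                  ≡⟨ x^[q^n]≡x x ⟩
          x                              ≡⟨ *-identityʳ x ⟨
          x * 1#                         ∎)

    -- The field is the disjoint union of at most q fixed elements and at most q^n - q others; as
    -- the total is q^n, the first bound is attained.
    #fixed : ∀ k → normExp n ≡ suc k → length fixed ≡ q
    #fixed k N≡1+k = ℕ.≤-antisym fixed≤q (ℕ.+-cancelʳ-≤ (suc m ℕ.* k) q (length fixed)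
      (ℕ.≤-trans (ℕ.≤-reflexive total) (ℕ.+-monoʳ-≤ (length fixed) (unfixed≤ k N≡1+k))))
      where
      total : q ℕ.+ suc m ℕ.* k ≡ length fixed ℕ.+ length unfixed
      total = begin
        q ℕ.+ suc m ℕ.* k                    ≡⟨ cong (ℕ._+ suc m ℕ.* k) q≡2+m ⟩
        suc (suc m ℕ.+ suc m ℕ.* k)          ≡⟨ cong suc (ℕ.*-suc (suc m) k) ⟨
        suc (suc m ℕ.* suc k)                ≡⟨ cong (λ j → suc (suc m ℕ.* j)) N≡1+k ⟨
        suc (suc m ℕ.* normExp n)            ≡⟨ q^j≡1+[q-1]*normExp n ⟨
        q ℕ.^ n                              ≡⟨ size≡q^n ⟨
        size                                 ≡⟨ length-tabulate element ⟨
        length elements                      ≡⟨ length-filter-∁ InFq? elements ⟨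
        length fixed ℕ.+ length unfixed      ∎

  length-fixed : length fixed ≡ q
  length-fixed = #fixed (q ℕ.∸ 2) (sym (ℕ.m+[n∸m]≡n 1<q)) (ℕ.pred (normExp n))
    (sym (ℕ.suc-pred (normExp n) {{ℕ.>-nonZero (0<normExp n 0<n)}}))
    where
    0<normExp : ∀ j → 0 ℕ.< j → 0 ℕ.< normExp j
    0<normExp (suc j) _ = ℕ.<-≤-trans (ℕ.m^n>0 q j) (ℕ.m≤m+n (q ℕ.^ j) (normExp j))

  abstract
    fixedElement : Fin q → K
    fixedElement i = List.lookup fixed (Fin.cast (sym length-fixed) i)

    fixedElement-InFq : ∀ i → InFq (fixedElement i)
    fixedElement-InFq i = ListAll.lookup (all-filter InFq? elements) (∈-lookup {xs = fixed} (Fin.cast (sym length-fixed) i))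

    fixedElement-injective : ∀ {i j} → fixedElement i ≡ fixedElement j → i ≡ j
    fixedElement-injective {i} {j} eq = Fin.toℕ-injective (trans (sym (Fin.toℕ-cast _ i))
      (trans (cong toℕ (lookup-injective (filter⁺ InFq? elements-unique) eq)) (Fin.toℕ-cast _ j)))

    fixedElement-surjective : ∀ {x} → InFq x → ∃ λ i → fixedElement i ≡ x
    fixedElement-surjective {x} x∈Fq = Fin.cast length-fixed (Any.index x∈fixed) ,
      trans (cong (List.lookup fixed) (Fin.cast-involutive (sym length-fixed) length-fixed (Any.index x∈fixed)))
            (sym (lookup-index x∈fixed))
      where
      x∈fixed : x ∈ fixed
      x∈fixed = ∈-filter⁺ InFq? (subst (_∈ elements) (element-index x) (∈-tabulate⁺ (index x))) x∈Fq

-- A basis over the fixed field, by counting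

module Basis (F : FiniteField) (q n : ℕ)
  (isPrimePower : IsPrimePower q) (0<n : 0 ℕ.< n) (size≡q^n : FiniteField.size F ≡ q ℕ.^ n) where
  open Geom F q n
  open FieldProperties F q n
  open FrobeniusProperties F q n isPrimePower 0<n size≡q^n
  open ≡-Reasoning

  combination : ∀ {k} → Vec K k → Vec K k → K
  combination []       []       = 0#
  combination (c ∷ cs) (x ∷ xs) = c * x + combination cs xs

  Independent : ∀ {k} → Vec K k → Set
  Independent {k} xs = (cs : Vec K k) → All InFq cs → combination cs xs ≡ 0# → All (_≡ 0#) cs

  -- Numbers the vectors of F_q^k by their base-q digits. Independent or spanning families then give
  -- injections between finite sets, hence inequalities between q^k and q^n.
  coefficients : ∀ k → Fin (q ℕ.^ k) → Vec K k
  coefficients zero    _ = []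
  coefficients (suc k) j = let a , b = remQuot {q} (q ℕ.^ k) j in fixedElement a ∷ coefficients k b

  coefficients-InFq : ∀ k j → All InFq (coefficients k j)
  coefficients-InFq zero    _ = []
  coefficients-InFq (suc k) j = fixedElement-InFq _ ∷ coefficients-InFq k _

  coefficients-injective : ∀ k {i j} → coefficients k i ≡ coefficients k j → i ≡ j
  coefficients-injective zero    {zero} {zero} _  = refl
  coefficients-injective (suc k) {i}    {j}    eq = begin
    i                                         ≡⟨ Fin.combine-remQuot {q} (q ℕ.^ k) i ⟨
    uncurry combine (remQuot {q} (q ℕ.^ k) i) ≡⟨ cong₂ combine (fixedElement-injective (cong Vec.head eq))
                                                   (coefficients-injective k (cong Vec.tail eq)) ⟩
    uncurry combine (remQuot {q} (q ℕ.^ k) j) ≡⟨ Fin.combine-remQuot {q} (q ℕ.^ k) j ⟩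
    j                                         ∎

  coefficients-surjective : ∀ {k} {cs : Vec K k} → All InFq cs → ∃ λ j → coefficients k j ≡ cs
  coefficients-surjective []               = zero , refl
  coefficients-surjective {suc k} (c∈ ∷ cs∈) with fixedElement-surjective c∈ | coefficients-surjective cs∈
  ... | a , refl | b , refl = combine a b ,
    cong (λ (a , b) → fixedElement a ∷ coefficients k b) (Fin.remQuot-combine a b)

  combination-difference : ∀ {k} (cs ds xs : Vec K k) →
    combination (Vec.zipWith _-_ cs ds) xs ≡ combination cs xs - combination ds xs
  combination-difference []       []       []       = sym (-‿inverseʳ 0#)
  combination-difference (c ∷ cs) (d ∷ ds) (x ∷ xs) = trans
    (cong ((c - d) * x +_) (combination-difference cs ds xs))
    (solve 5 (λ c d x s t → (c :- d) :* x :+ (s :- t) := (c :* x :+ s) :- (d :* x :+ t)) refl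
      c d x (combination cs xs) (combination ds xs))

  combination-injective : ∀ {k} {xs : Vec K k} → Independent xs → ∀ {cs ds} → All InFq cs → All InFq ds →
                          combination cs xs ≡ combination ds xs → cs ≡ ds
  combination-injective {xs = xs} independent {cs} {ds} cs∈ ds∈ eq =
    equal cs ds (independent (Vec.zipWith _-_ cs ds) (differences cs∈ ds∈)
      (trans (combination-difference cs ds xs) (trans (cong (_- combination ds xs) eq) (-‿inverseʳ _))))
    where
    differences : ∀ {k} {cs ds : Vec K k} → All InFq cs → All InFq ds → All InFq (Vec.zipWith _-_ cs ds)
    differences []         []         = []
    differences (c∈ ∷ cs∈) (d∈ ∷ ds∈) = InFq-+ c∈ (InFq-neg d∈) ∷ differences cs∈ ds∈
    equal : ∀ {k} (cs ds : Vec K k) → All (_≡ 0#) (Vec.zipWith _-_ cs ds) → cs ≡ ds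
    equal []       []       []        = refl
    equal (c ∷ cs) (d ∷ ds) (eq ∷ eqs) = cong₂ _∷_ (x-y≡0⇒x≡y c d eq) (equal cs ds eqs)

  independent⇒q^k≤q^n : ∀ {k} {xs : Vec K k} → Independent xs → q ℕ.^ k ≤ q ℕ.^ n
  independent⇒q^k≤q^n {k} {xs} independent = subst (q ℕ.^ k ≤_) size≡q^n
    (Fin.injective⇒≤ {f = λ j → index (combination (coefficients k j) xs)} λ eq →
      coefficients-injective k (combination-injective independent (coefficients-InFq k _) (coefficients-InFq k _)
        (index-injective eq)))

  -- Quantifying over the index of a coefficient vector, not over the vector, makes membership
  -- decidable by finite search.
  InSpan : ∀ {k} → Vec K k → K → Set
  InSpan {k} xs x = ∃ λ j → combination (coefficients k j) xs ≡ x

  InSpan? : ∀ {k} (xs : Vec K k) x → Dec (InSpan xs x)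
  InSpan? {k} xs x = Fin.any? λ j → combination (coefficients k j) xs ≟ x

  spanning⇒q^n≤q^k : ∀ {k} {xs : Vec K k} → (∀ i → InSpan xs (element i)) → q ℕ.^ n ≤ q ℕ.^ k
  spanning⇒q^n≤q^k {k} {xs} spanning = subst (_≤ q ℕ.^ k) size≡q^n
    (Fin.injective⇒≤ {f = λ i → proj₁ (spanning i)} λ {i} {j} eq →
      element-injective (trans (sym (proj₂ (spanning i)))
        (trans (cong (λ l → combination (coefficients k l) xs) eq) (proj₂ (spanning j)))))

  combination-scale : ∀ {k} a (cs xs : Vec K k) → combination (Vec.map (a *_) cs) xs ≡ a * combination cs xs
  combination-scale a []       []       = sym (zeroʳ a)
  combination-scale a (c ∷ cs) (x ∷ xs) = trans (cong (a * c * x +_) (combination-scale a cs xs))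
    (solve 4 (λ a c x s → a :* c :* x :+ a :* s := a :* (c :* x :+ s)) refl a c x (combination cs xs))

  scale-InFq : ∀ {k a} {cs : Vec K k} → InFq a → All InFq cs → All InFq (Vec.map (a *_) cs)
  scale-InFq a∈ []         = []
  scale-InFq a∈ (c∈ ∷ cs∈) = InFq-* a∈ c∈ ∷ scale-InFq a∈ cs∈

  dependent⇒InSpan : ∀ {k} {xs : Vec K k} {x c} {cs : Vec K k} → InFq c → All InFq cs → c ≢ 0# →
                     c * x + combination cs xs ≡ 0# → InSpan xs x
  dependent⇒InSpan {k} {xs} {x} {c} {cs} c∈ cs∈ c≢0 eq = proj₁ scaled , (begin
      combination (coefficients k (proj₁ scaled)) xs ≡⟨ cong (λ ds → combination ds xs) (proj₂ scaled) ⟩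
      combination (Vec.map ((- d) *_) cs) xs         ≡⟨ combination-scale (- d) cs xs ⟩
      (- d) * S
        ≡⟨ solve 4 (λ c d x S → (:- d) :* S := c :* d :* x :- d :* (c :* x :+ S)) refl c d x S ⟩
      c * d * x - d * (c * x + S)                    ≡⟨ cong₂ (λ u v → u * x - d * v) c*d≡1 eq ⟩
      1# * x - d * 0#                                ≡⟨ solve 2 (λ d x → :1 :* x :- d :* :0 := x) refl d x ⟩
      x                                              ∎)
    where
    d = proj₁ (inverse c c≢0)
    c*d≡1 = proj₂ (inverse c c≢0)
    S = combination cs xs
    scaled : ∃ λ j → coefficients k j ≡ Vec.map ((- d) *_) cs
    scaled = coefficients-surjective (scale-InFq (InFq-neg (InFq-inverse c≢0 c∈ c*d≡1)) cs∈)

  extend-independent : ∀ {k} {xs : Vec K k} {x} → Independent xs → ¬ InSpan xs x → Independent (x ∷ xs)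
  extend-independent {k} {xs} {x} independent x∉span (c ∷ cs) (c∈ ∷ cs∈) eq =
    c≡0 ∷ independent cs cs∈ (begin
      combination cs xs            ≡⟨ solve 2 (λ x s → s := :0 :* x :+ s) refl x (combination cs xs) ⟩
      0# * x + combination cs xs   ≡⟨ cong (λ z → z * x + combination cs xs) c≡0 ⟨
      c * x + combination cs xs    ≡⟨ eq ⟩
      0#                           ∎)
    where
    c≡0 : c ≡ 0#
    c≡0 = decidable-stable (c ≟ 0#) λ c≢0 → x∉span (dependent⇒InSpan c∈ cs∈ c≢0 eq)

  -- Greedy choice: for k < n the q^k combinations cannot exhaust the q^n elements, so some element
  -- lies outside the span and extends the family.
  independentFamily : ∀ k → k ≤ n → Σ (Vec K k) Independent
  independentFamily zero    _   = [] , λ { [] _ _ → [] }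
  independentFamily (suc k) k<n with independentFamily k (ℕ.<⇒≤ k<n)
  ... | xs , independent with Fin.all? (λ i → InSpan? xs (element i))
  ...   | yes spanning = contradiction (spanning⇒q^n≤q^k {xs = xs} spanning) (ℕ.<⇒≱ (ℕ.^-monoʳ-< q 1<q k<n))
  ...   | no ¬spanning with Fin.¬∀⟶∃¬ _ _ (λ i → InSpan? xs (element i)) ¬spanning
  ...     | i , i∉span = element i ∷ xs , extend-independent independent i∉span

  abstract
    basis : Vec K n
    basis = proj₁ (independentFamily n ℕ.≤-refl)

    basis-independent : Independent basis
    basis-independent = proj₂ (independentFamily n ℕ.≤-refl)

  -- An element outside the span would yield n + 1 independent elements and thus q^(n + 1) ≤ q^n.
  basis-spanning : ∀ x → ∃ λ cs → All InFq cs × x ≡ combination cs basis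
  basis-spanning x with InSpan? basis x
  ... | yes (j , eq) = coefficients n j , coefficients-InFq n j , sym eq
  ... | no x∉span    = contradiction (independent⇒q^k≤q^n (extend-independent basis-independent x∉span))
                                     (ℕ.<⇒≱ (ℕ.^-monoʳ-< q 1<q (ℕ.n<1+n n)))

-- Coprime Frobenius exponents and non-squares in the extension

module FieldExtension (F : FiniteField) (q n : ℕ)
  (isPrimePower : IsPrimePower q) (0<n : 0 ℕ.< n) (size≡q^n : FiniteField.size F ≡ q ℕ.^ n) where
  open Geom F q n
  open FieldProperties F q n
  open FrobeniusProperties F q n isPrimePower 0<n size≡q^n
  open ≡-Reasoning

  -- The map g is injective. Were y outside its image, then y together with all values of g would
  -- give `size` + 1 distinct elements; so g is onto and its one-sided inverse is two-sided.
  leftInverse⇒rightInverse : ∀ {f g : K → K} → (∀ x → f (g x) ≡ x) → ∀ x → g (f x) ≡ x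
  leftInverse⇒rightInverse {f} {g} f∘g y with Fin.any? (λ i → g (element i) ≟ y)
  ... | yes (i , refl) = cong g (f∘g (element i))
  ... | no y∉image     = contradiction (Fin.injective⇒≤ {f = λ i → index (h i)} (h-injective ∘ index-injective))
                                       (ℕ.<⇒≱ (ℕ.n<1+n size))
    where
    h : Fin (suc size) → K
    h zero    = y
    h (suc i) = g (element i)
    h-injective : ∀ {i j} → h i ≡ h j → i ≡ j
    h-injective {zero}  {zero}  _  = refl
    h-injective {zero}  {suc j} eq = contradiction (j , sym eq) y∉image
    h-injective {suc i} {zero}  eq = contradiction (i , eq) y∉image
    h-injective {suc i} {suc j} eq = cong suc (element-injective
      (trans (sym (f∘g (element i))) (trans (cong f eq) (f∘g (element j)))))

  x^[q^[k*j]]≡x : ∀ {x} j → x ^ (q ℕ.^ j) ≡ x → ∀ k → x ^ (q ℕ.^ (k ℕ.* j)) ≡ x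
  x^[q^[k*j]]≡x {x} j x-fixed zero    = *-identityʳ x
  x^[q^[k*j]]≡x {x} j x-fixed (suc k) = begin
    x ^ (q ℕ.^ (j ℕ.+ k ℕ.* j))            ≡⟨ cong (x ^_) (ℕ.^-distribˡ-+-* q j (k ℕ.* j)) ⟩
    x ^ (q ℕ.^ j ℕ.* q ℕ.^ (k ℕ.* j))      ≡⟨ ^-assocʳ x (q ℕ.^ j) (q ℕ.^ (k ℕ.* j)) ⟨
    (x ^ (q ℕ.^ j)) ^ (q ℕ.^ (k ℕ.* j))    ≡⟨ cong (_^ (q ℕ.^ (k ℕ.* j))) x-fixed ⟩
    x ^ (q ℕ.^ (k ℕ.* j))                  ≡⟨ x^[q^[k*j]]≡x j x-fixed k ⟩
    x                                      ∎

  -- The iterate tj = 1 + si of Frobenius fixes x, and so does the iterate si; what remains is a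
  -- single application of Frobenius.
  bézout⇒InFq : ∀ {x} i s j t → 1 ℕ.+ s ℕ.* i ≡ t ℕ.* j →
                x ^ (q ℕ.^ i) ≡ x → x ^ (q ℕ.^ j) ≡ x → InFq x
  bézout⇒InFq {x} i s j t eq xᵢ xⱼ = begin
    x ^ q                                ≡⟨ cong (_^ q) (x^[q^[k*j]]≡x i xᵢ s) ⟨
    (x ^ (q ℕ.^ (s ℕ.* i))) ^ q          ≡⟨ ^-assocʳ x (q ℕ.^ (s ℕ.* i)) q ⟩
    x ^ (q ℕ.^ (s ℕ.* i) ℕ.* q)          ≡⟨ cong (x ^_) (ℕ.*-comm (q ℕ.^ (s ℕ.* i)) q) ⟩
    x ^ (q ℕ.^ (1 ℕ.+ s ℕ.* i))          ≡⟨ cong (λ k → x ^ (q ℕ.^ k)) eq ⟩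
    x ^ (q ℕ.^ (t ℕ.* j))                ≡⟨ x^[q^[k*j]]≡x j xⱼ t ⟩
    x                                    ∎

  coprime⇒InFq : ∀ {x} i j → Coprime i j → x ^ (q ℕ.^ i) ≡ x → x ^ (q ℕ.^ j) ≡ x → InFq x
  coprime⇒InFq i j i⊥j xᵢ xⱼ with coprime-Bézout i⊥j
  ... | Bézout.+- s t eq = bézout⇒InFq j t i s eq xⱼ xᵢ
  ... | Bézout.-+ s t eq = bézout⇒InFq i s j t eq xᵢ xⱼ

  -- A common divisor of j and r mod j also divides r = (r mod j) + (r div j) j. This passes from
  -- the integer r to the natural exponent used by `frob`.
  coprime-modN : ∀ j r → 0 ℕ.< j → Coprime j ∣ r ∣ → Coprime j (modN j r)
  coprime-modN (suc m) r _ j⊥r {d} (d∣j , d∣r%j) = j⊥r (d∣j , ℤ.∣⇒∣ᵤ (subst (ℤ.+ d ℤ.∣_)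
    (sym (a≡a%ℕn+[a/ℕn]*n r (suc m)))
    (ℤ.∣m∣n⇒∣m+n {m = ℤ.+ (r ℤ.%ℕ suc m)} (ℤ.∣ᵤ⇒∣ d∣r%j)
      (ℤ.∣n⇒∣m*n (r ℤ./ℕ suc m) {ℤ.+ suc m} (ℤ.∣ᵤ⇒∣ {i = ℤ.+ suc m} d∣j)))))

  -- Otherwise the numbering of F_q would inject q^n elements into q indices.
  ∃-∉Fq : 1 ℕ.< n → ∃ λ x → ¬ InFq x
  ∃-∉Fq 1<n with Fin.all? (λ i → InFq? (element i))
  ... | no ¬all = let i , i∉Fq = Fin.¬∀⟶∃¬ _ _ (λ i → InFq? (element i)) ¬all in element i , i∉Fq
  ... | yes all = contradiction (Fin.injective⇒≤ {f = λ i → proj₁ (preimage i)} λ {i} {j} eq → element-injective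
      (trans (sym (proj₂ (preimage i))) (trans (cong fixedElement eq) (proj₂ (preimage j)))))
      (ℕ.<⇒≱ (subst (q ℕ.<_) (sym size≡q^n) (subst (ℕ._< q ℕ.^ n) (ℕ.*-identityʳ q) (ℕ.^-monoʳ-< q 1<q 1<n))))
    where
    preimage : ∀ i → ∃ λ j → fixedElement j ≡ element i
    preimage i = fixedElement-surjective (all i)

  -- Since q = 1 + 2h and q · 1 = 0, the equation 2 = 0 would give 1 = 0.
  two≢0 : Odd q → two ≢ 0#
  two≢0 q-odd two≡0 = 0≢1 (begin
    0#                                   ≡⟨ q·1≡0 ⟨
    q · 1#
      ≡⟨ cong (_· 1#) (trans (m≡m%n+[m/n]*n q 2) (cong (ℕ._+ q ℕ./ 2 ℕ.* 2) q-odd)) ⟩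
    1# + (q ℕ./ 2 ℕ.* 2) · 1#            ≡⟨ cong (1# +_) (·1-homo-* (q ℕ./ 2) 2) ⟩
    1# + (q ℕ./ 2) · 1# * (1# + (1# + 0#))  ≡⟨ cong (λ z → 1# + (q ℕ./ 2) · 1# * (1# + z)) (+-identityʳ 1#) ⟩
    1# + (q ℕ./ 2) · 1# * two            ≡⟨ cong (λ z → 1# + (q ℕ./ 2) · 1# * z) two≡0 ⟩
    1# + (q ℕ./ 2) · 1# * 0#             ≡⟨ solve 1 (λ z → :1 :+ z :* :0 := :1) refl ((q ℕ./ 2) · 1#) ⟩
    1#                                   ∎)

  -- A square root z ∉ F_q of ξ would satisfy z^q = −z, hence z = z^(q^n) = −z as n is odd.
  nonSquare : two ≢ 0# → Odd n → ∀ {ξ} → NonSquareFq ξ → ∀ z → z * z ≢ ξ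
  nonSquare 2≢0 n-odd {ξ} (ξ∈Fq , ξ-nonSquare) z z²≡ξ with z ^ q - z ≟ 0#
  ... | yes eq = ξ-nonSquare z (x-y≡0⇒x≡y _ _ eq) z²≡ξ
  ... | no neq = ξ-nonSquare z (subst InFq (sym z≡0) InFq-0) z²≡ξ
    where
    z^q≡-z : z ^ q ≡ - z
    z^q≡-z = begin
      z ^ q                ≡⟨ solve 2 (λ y z → y := (y :+ z) :- z) refl (z ^ q) z ⟩
      (z ^ q + z) - z      ≡⟨ cong (_- z) (x*y≡0⇒y≡0 neq (begin
        (z ^ q - z) * (z ^ q + z)    ≡⟨ solve 2 (λ y z → (y :- z) :* (y :+ z) := y :* y :- z :* z) refl (z ^ q) z ⟩
        z ^ q * z ^ q - z * z        ≡⟨ cong (_- z * z) (^-distrib-* z z q) ⟨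
        (z * z) ^ q - z * z          ≡⟨ cong (λ y → y ^ q - y) z²≡ξ ⟩
        ξ ^ q - ξ                    ≡⟨ cong (_- ξ) ξ∈Fq ⟩
        ξ - ξ                        ≡⟨ -‿inverseʳ ξ ⟩
        0#                           ∎)) ⟩
      0# - z               ≡⟨ +-identityˡ _ ⟩
      - z                  ∎
    z^[q^2]≡z : z ^ (q ℕ.^ 2) ≡ z
    z^[q^2]≡z = begin
      z ^ (q ℕ.* (q ℕ.* 1)) ≡⟨ cong (λ j → z ^ (q ℕ.* j)) (ℕ.*-identityʳ q) ⟩
      z ^ (q ℕ.* q)        ≡⟨ ^-assocʳ z q q ⟨
      (z ^ q) ^ q          ≡⟨ cong (_^ q) z^q≡-z ⟩
      (- z) ^ q            ≡⟨ [-x]^q z ⟩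
      - (z ^ q)            ≡⟨ cong (λ y → - y) z^q≡-z ⟩
      - - z                ≡⟨ solve 1 (λ z → :- (:- z) := z) refl z ⟩
      z                    ∎
    h = n ℕ./ 2
    z≡-z : z ≡ - z
    z≡-z = begin
      z                                ≡⟨ x^[q^n]≡x z ⟨
      z ^ (q ℕ.^ n)
        ≡⟨ cong (λ j → z ^ (q ℕ.^ j)) (trans (m≡m%n+[m/n]*n n 2) (cong (ℕ._+ h ℕ.* 2) n-odd)) ⟩
      z ^ (q ℕ.* q ℕ.^ (h ℕ.* 2))      ≡⟨ ^-assocʳ z q (q ℕ.^ (h ℕ.* 2)) ⟨
      (z ^ q) ^ (q ℕ.^ (h ℕ.* 2))      ≡⟨ cong (_^ (q ℕ.^ (h ℕ.* 2))) z^q≡-z ⟩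
      (- z) ^ (q ℕ.^ (h ℕ.* 2))        ≡⟨ [-x]^[q^k] (h ℕ.* 2) z ⟩
      - (z ^ (q ℕ.^ (h ℕ.* 2)))        ≡⟨ cong (λ y → - y) (x^[q^[k*j]]≡x 2 z^[q^2]≡z h) ⟩
      - z                              ∎
    z≡0 : z ≡ 0#
    z≡0 = x*y≡0⇒y≡0 2≢0 (begin
      two * z     ≡⟨ solve 1 (λ z → (:1 :+ :1) :* z := z :+ z) refl z ⟩
      z + z       ≡⟨ cong (z +_) z≡-z ⟩
      z - z       ≡⟨ -‿inverseʳ z ⟩
      0#          ∎)

-- Vectors and lines of the projective space

module ProjectiveSpace (F : FiniteField) (q n : ℕ) where
  open Geom F q n
  open FieldProperties F q n
  open ≡-Reasoning

  ⟨⟩-cong : ∀ {a b c d a′ b′ c′ d′ : K} → a ≡ a′ → b ≡ b′ → c ≡ c′ → d ≡ d′ →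
            ⟨ a , b , c , d ⟩ ≡ ⟨ a′ , b′ , c′ , d′ ⟩
  ⟨⟩-cong refl refl refl refl = refl

  ⊕-identityˡ : ∀ v → zeroV ⊕ v ≡ v
  ⊕-identityˡ ⟨ a , b , c , d ⟩ = ⟨⟩-cong (+-identityˡ a) (+-identityˡ b) (+-identityˡ c) (+-identityˡ d)

  ⊕-identityʳ : ∀ v → v ⊕ zeroV ≡ v
  ⊕-identityʳ ⟨ a , b , c , d ⟩ = ⟨⟩-cong (+-identityʳ a) (+-identityʳ b) (+-identityʳ c) (+-identityʳ d)

  ⊕-assoc : ∀ u v w → (u ⊕ v) ⊕ w ≡ u ⊕ (v ⊕ w)
  ⊕-assoc ⟨ a , b , c , d ⟩ ⟨ a′ , b′ , c′ , d′ ⟩ ⟨ a″ , b″ , c″ , d″ ⟩ =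
    ⟨⟩-cong (+-assoc a a′ a″) (+-assoc b b′ b″) (+-assoc c c′ c″) (+-assoc d d′ d″)

  0•v≡0 : ∀ v → 0# • v ≡ zeroV
  0•v≡0 ⟨ a , b , c , d ⟩ = ⟨⟩-cong (zeroˡ a) (zeroˡ b) (zeroˡ c) (zeroˡ d)

  •-assoc : ∀ j k v → (j * k) • v ≡ j • (k • v)
  •-assoc j k ⟨ a , b , c , d ⟩ = ⟨⟩-cong (*-assoc j k a) (*-assoc j k b) (*-assoc j k c) (*-assoc j k d)

  k•v≡0⇒v≡0 : ∀ {k v} → k ≢ 0# → k • v ≡ zeroV → v ≡ zeroV
  k•v≡0⇒v≡0 k≢0 eq = ⟨⟩-cong (x*y≡0⇒y≡0 k≢0 (cong V4.c0 eq)) (x*y≡0⇒y≡0 k≢0 (cong V4.c1 eq))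
                             (x*y≡0⇒y≡0 k≢0 (cong V4.c2 eq)) (x*y≡0⇒y≡0 k≢0 (cong V4.c3 eq))

  k•v≡0⇒k≡0 : ∀ {k v} → v ≢ zeroV → k • v ≡ zeroV → k ≡ 0#
  k•v≡0⇒k≡0 {k} v≢0 eq = decidable-stable (k ≟ 0#) λ k≢0 → v≢0 (k•v≡0⇒v≡0 k≢0 eq)

  •-⊕-interchange : ∀ α β a c a′ c′ u w →
    (α • ((a • u) ⊕ (c • w))) ⊕ (β • ((a′ • u) ⊕ (c′ • w))) ≡
    ((α * a + β * a′) • u) ⊕ ((α * c + β * c′) • w)
  •-⊕-interchange α β a c a′ c′ ⟨ u₀ , u₁ , u₂ , u₃ ⟩ ⟨ w₀ , w₁ , w₂ , w₃ ⟩ =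
    ⟨⟩-cong (coordinate u₀ w₀) (coordinate u₁ w₁) (coordinate u₂ w₂) (coordinate u₃ w₃)
    where
    coordinate : ∀ u w → α * (a * u + c * w) + β * (a′ * u + c′ * w) ≡ (α * a + β * a′) * u + (α * c + β * c′) * w
    coordinate = solve 8 (λ α β a c a′ c′ u w →
      α :* (a :* u :+ c :* w) :+ β :* (a′ :* u :+ c′ :* w) := (α :* a :+ β :* a′) :* u :+ (α :* c :+ β :* c′) :* w)
      refl α β a c a′ c′

  OnLine-combination : ∀ ℓ {v w} → OnLine ℓ v → OnLine ℓ w → ∀ α β → OnLine ℓ ((α • v) ⊕ (β • w))
  OnLine-combination (line u w _) (a , c , refl) (a′ , c′ , refl) α β =
    α * a + β * a′ , α * c + β * c′ , •-⊕-interchange α β a c a′ c′ u w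

  •-distrib-⊕ : ∀ k v w → k • (v ⊕ w) ≡ (k • v) ⊕ (k • w)
  •-distrib-⊕ k ⟨ a , b , c , d ⟩ ⟨ a′ , b′ , c′ , d′ ⟩ =
    ⟨⟩-cong (distribˡ k a a′) (distribˡ k b b′) (distribˡ k c c′) (distribˡ k d d′)

  OnLine-• : ∀ ℓ {v} → OnLine ℓ v → ∀ k → OnLine ℓ (k • v)
  OnLine-• (line u w _) (a , c , refl) k = k * a , k * c ,
    trans (•-distrib-⊕ k (a • u) (c • w)) (sym (cong₂ _⊕_ (•-assoc k a u) (•-assoc k c w)))

  Independent₂ : V4 → V4 → Set
  Independent₂ v w = ∀ α β → (α • v) ⊕ (β • w) ≡ zeroV → α ≡ 0# × β ≡ 0#

  -- Cramer's rule in the coordinates of ℓ. If the determinant D vanished, (c′, -c) and (-a′, a)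
  -- would be relations between v and w, so a = c = 0; then v = 0, and (1, 0) would be a relation
  -- too.
  onSpan : ∀ ℓ {v w} → Independent₂ v w → OnLine ℓ v → OnLine ℓ w →
           ∀ {x} → OnLine ℓ x → ∃ λ α → ∃ λ β → x ≡ (α • v) ⊕ (β • w)
  onSpan (line u t _) independent (a , c , refl) (a′ , c′ , refl) (α , β , refl) =
    e * (α * c′ - β * a′) , e * (β * a - α * c) , (begin
      (α • u) ⊕ (β • t)   ≡⟨ cong₂ (λ y z → (y • u) ⊕ (z • t)) cramer₁ cramer₂ ⟩
      ((e * (α * c′ - β * a′) * a + e * (β * a - α * c) * a′) • u) ⊕
      ((e * (α * c′ - β * a′) * c + e * (β * a - α * c) * c′) • t)
        ≡⟨ •-⊕-interchange (e * (α * c′ - β * a′)) (e * (β * a - α * c)) a c a′ c′ u t ⟨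
      ((e * (α * c′ - β * a′)) • ((a • u) ⊕ (c • t))) ⊕ ((e * (β * a - α * c)) • ((a′ • u) ⊕ (c′ • t))) ∎)
    where
    D = a * c′ - c * a′
    vanishing : ∀ j k → j * a + k * a′ ≡ 0# → j * c + k * c′ ≡ 0# → j ≡ 0# × k ≡ 0#
    vanishing j k eq₁ eq₂ = independent j k (begin
      (j • ((a • u) ⊕ (c • t))) ⊕ (k • ((a′ • u) ⊕ (c′ • t))) ≡⟨ •-⊕-interchange j k a c a′ c′ u t ⟩
      ((j * a + k * a′) • u) ⊕ ((j * c + k * c′) • t)         ≡⟨ cong₂ (λ y z → (y • u) ⊕ (z • t)) eq₁ eq₂ ⟩
      (0# • u) ⊕ (0# • t)                                     ≡⟨ cong₂ _⊕_ (0•v≡0 u) (0•v≡0 t) ⟩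
      zeroV ⊕ zeroV                                           ≡⟨ ⊕-identityˡ zeroV ⟩
      zeroV                                                   ∎)
    D≢0 : D ≢ 0#
    D≢0 D≡0 = 0≢1 (sym (proj₁ (vanishing 1# 0#
      (trans (cong (λ z → 1# * z + 0# * a′) a≡0) (solve 1 (λ a′ → :1 :* :0 :+ :0 :* a′ := :0) refl a′))
      (trans (cong (λ z → 1# * z + 0# * c′) c≡0) (solve 1 (λ c′ → :1 :* :0 :+ :0 :* c′ := :0) refl c′)))))
      where
      -x≡0⇒x≡0 : ∀ {x} → - x ≡ 0# → x ≡ 0#
      -x≡0⇒x≡0 {x} eq = trans (solve 1 (λ x → x := :- (:- x)) refl x)
        (trans (cong (λ z → - z) eq) (solve 0 (:- :0 := :0) refl))
      c≡0 : c ≡ 0#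
      c≡0 = -x≡0⇒x≡0 (proj₂ (vanishing c′ (- c)
        (trans (solve 4 (λ a c a′ c′ → c′ :* a :+ (:- c) :* a′ := a :* c′ :- c :* a′) refl a c a′ c′) D≡0)
        (solve 2 (λ c c′ → c′ :* c :+ (:- c) :* c′ := :0) refl c c′)))
      a≡0 : a ≡ 0#
      a≡0 = proj₂ (vanishing (- a′) a
        (solve 2 (λ a a′ → (:- a′) :* a :+ a :* a′ := :0) refl a a′)
        (trans (solve 4 (λ a c a′ c′ → (:- a′) :* c :+ a :* c′ := a :* c′ :- c :* a′) refl a c a′ c′) D≡0))
    e = proj₁ (inverse D D≢0)
    D*e≡1 = proj₂ (inverse D D≢0)
    cramer₁ : α ≡ e * (α * c′ - β * a′) * a + e * (β * a - α * c) * a′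
    cramer₁ = trans (trans (sym (*-identityˡ α)) (cong (_* α) (sym D*e≡1)))
      (solve 7 (λ a c a′ c′ α β e → (a :* c′ :- c :* a′) :* e :* α :=
        e :* (α :* c′ :- β :* a′) :* a :+ e :* (β :* a :- α :* c) :* a′) refl a c a′ c′ α β e)
    cramer₂ : β ≡ e * (α * c′ - β * a′) * c + e * (β * a - α * c) * c′
    cramer₂ = trans (trans (sym (*-identityˡ β)) (cong (_* β) (sym D*e≡1)))
      (solve 7 (λ a c a′ c′ α β e → (a :* c′ :- c :* a′) :* e :* β :=
        e :* (α :* c′ :- β :* a′) :* c :+ e :* (β :* a :- α :* c) :* c′) refl a c a′ c′ α β e)

  sameLine : ∀ ℓ {v w} (independent : Independent₂ v w) → OnLine ℓ v → OnLine ℓ w → SameLine ℓ (line v w independent)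
  sameLine ℓ independent v∈ℓ w∈ℓ x = onSpan ℓ independent v∈ℓ w∈ℓ , λ { (α , β , refl) → OnLine-combination ℓ v∈ℓ w∈ℓ α β }

-- Dimension over F_q of images of F_q-linear maps

module Dimension (F : FiniteField) (q n : ℕ)
  (isPrimePower : IsPrimePower q) (0<n : 0 ℕ.< n) (size≡q^n : FiniteField.size F ≡ q ℕ.^ n) where
  open Geom F q n
  open FieldProperties F q n
  open FrobeniusProperties F q n isPrimePower 0<n size≡q^n
  open Basis F q n isPrimePower 0<n size≡q^n
  open ProjectiveSpace F q n
  open ≡-Reasoning

  lincomb-++ : ∀ {j k} (cs : Vec K j) (ds : Vec K k) (vs : Vec V4 j) (ws : Vec V4 k) →
               lincomb (cs ++ ds) (vs ++ ws) ≡ lincomb cs vs ⊕ lincomb ds ws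
  lincomb-++ []       ds []       ws = sym (⊕-identityˡ _)
  lincomb-++ (c ∷ cs) ds (v ∷ vs) ws =
    trans (cong ((c • v) ⊕_) (lincomb-++ cs ds vs ws)) (sym (⊕-assoc (c • v) (lincomb cs vs) (lincomb ds ws)))

  -- Homogeneity is restricted to scalars of F_q because the maps in question involve σ, which only
  -- these scalars pass through unchanged.
  record IsFqLinear (L : K → V4) : Set where
    field
      additive    : ∀ x y → L (x + y) ≡ L x ⊕ L y
      homogeneous : ∀ {c} → InFq c → ∀ x → L (c * x) ≡ c • L x

    lincomb-map : ∀ {k} {cs : Vec K k} → All InFq cs → ∀ xs → lincomb cs (Vec.map L xs) ≡ L (combination cs xs)
    lincomb-map []                    []       = begin
      zeroV        ≡⟨ 0•v≡0 (L 0#) ⟨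
      0# • L 0#    ≡⟨ homogeneous InFq-0 0# ⟨
      L (0# * 0#)  ≡⟨ cong L (zeroˡ 0#) ⟩
      L 0#         ∎
    lincomb-map {cs = c ∷ cs} (c∈ ∷ cs∈) (x ∷ xs) = begin
      (c • L x) ⊕ lincomb cs (Vec.map L xs)    ≡⟨ cong₂ _⊕_ (sym (homogeneous c∈ x)) (lincomb-map cs∈ xs) ⟩
      L (c * x) ⊕ L (combination cs xs)        ≡⟨ additive (c * x) (combination cs xs) ⟨
      L (c * x + combination cs xs)            ∎
  open IsFqLinear

  hasFqDim-n : ∀ {L S} → IsFqLinear L → (∀ x → L x ≡ zeroV → x ≡ 0#) →
               (∀ x → S (L x)) → (∀ v → S v → ∃ λ x → v ≡ L x) → HasFqDim S n
  hasFqDim-n {L} {S} linear injective L⊆S S⊆L = Vec.map L basis ,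
    (λ cs cs∈ eq → basis-independent cs cs∈ (injective _ (trans (sym (lincomb-map linear cs∈ basis)) eq))) ,
    All.map⁺ (All.universal L⊆S basis) ,
    λ v v∈S → let x , v≡Lx = S⊆L v v∈S
                  cs , cs∈ , x≡ = basis-spanning x
              in cs , cs∈ , trans v≡Lx (trans (cong L x≡) (sym (lincomb-map linear cs∈ basis)))

  hasFqDim-2n : ∀ {L M S} → IsFqLinear L → IsFqLinear M →
                (∀ x y → L x ⊕ M y ≡ zeroV → x ≡ 0# × y ≡ 0#) →
                (∀ x → S (L x)) → (∀ y → S (M y)) →
                (∀ v → S v → ∃ λ x → ∃ λ y → v ≡ L x ⊕ M y) → HasFqDim S (2 ℕ.* n)
  hasFqDim-2n {L} {M} {S} L-linear M-linear injective L⊆S M⊆S S⊆L⊕M =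
    -- The trailing empty vector matches 2n, which unfolds to n + (n + 0).
    Ls ++ (Ms ++ []) , independent ,
    All.++⁺ (All.map⁺ (All.universal L⊆S basis)) (All.++⁺ (All.map⁺ (All.universal M⊆S basis)) []) ,
    spanning
    where
    Ls = Vec.map L basis
    Ms = Vec.map M basis
    lincomb≡ : ∀ {cs ds} → All InFq cs → All InFq ds →
               lincomb (cs ++ (ds ++ [])) (Ls ++ (Ms ++ [])) ≡ L (combination cs basis) ⊕ M (combination ds basis)
    lincomb≡ {cs} {ds} cs∈ ds∈ = begin
      lincomb (cs ++ (ds ++ [])) (Ls ++ (Ms ++ []))    ≡⟨ lincomb-++ cs (ds ++ []) Ls (Ms ++ []) ⟩
      lincomb cs Ls ⊕ lincomb (ds ++ []) (Ms ++ [])    ≡⟨ cong (lincomb cs Ls ⊕_) (lincomb-++ ds [] Ms []) ⟩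
      lincomb cs Ls ⊕ (lincomb ds Ms ⊕ zeroV)          ≡⟨ cong (lincomb cs Ls ⊕_) (⊕-identityʳ _) ⟩
      lincomb cs Ls ⊕ lincomb ds Ms
        ≡⟨ cong₂ _⊕_ (lincomb-map L-linear cs∈ basis) (lincomb-map M-linear ds∈ basis) ⟩
      L (combination cs basis) ⊕ M (combination ds basis) ∎
    independent : FqIndependent (Ls ++ (Ms ++ []))
    independent es es∈ eq with Vec.splitAt n es
    ... | cs , es′ , refl with Vec.splitAt n es′
    ...   | ds , [] , refl =
        All.++⁺ (basis-independent cs cs∈ (proj₁ vanish)) (All.++⁺ (basis-independent ds ds∈ (proj₂ vanish)) [])
      where
      cs∈ = proj₁ (All.++⁻ cs es∈)
      ds∈ = proj₁ (All.++⁻ ds (proj₂ (All.++⁻ cs es∈)))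
      vanish = injective _ _ (trans (sym (lincomb≡ cs∈ ds∈)) eq)
    spanning : ∀ v → S v → Σ (Vec K (2 ℕ.* n)) λ cs → All InFq cs × v ≡ lincomb cs (Ls ++ (Ms ++ []))
    spanning v v∈S =
      let x , y , v≡ = S⊆L⊕M v v∈S
          cs , cs∈ , x≡ = basis-spanning x
          ds , ds∈ , y≡ = basis-spanning y
      in cs ++ (ds ++ []) , All.++⁺ cs∈ (All.++⁺ ds∈ []) ,
         trans v≡ (trans (cong₂ (λ x y → L x ⊕ M y) x≡ y≡) (sym (lincomb≡ cs∈ ds∈)))

-- The pseudoregulus of a semilinear graph

module Pseudoregulus (F : FiniteField) (q n : ℕ)
  (isPrimePower : IsPrimePower q) (0<n : 0 ℕ.< n) (size≡q^n : FiniteField.size F ≡ q ℕ.^ n) where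
  open Geom F q n
  open FieldProperties F q n
  open FrobeniusProperties F q n isPrimePower 0<n size≡q^n
  open ProjectiveSpace F q n
  open Dimension F q n isPrimePower 0<n size≡q^n
  open ≡-Reasoning

  module Construction
    (two≢0 : two ≢ 0#) (ξ b : K) (ξ-nonSquare : ∀ z → z * z ≢ ξ) (b≢0 : b ≢ 0#)
    (σ : K → K) (σ-+ : ∀ x y → σ (x + y) ≡ σ x + σ y) (σ-* : ∀ x y → σ (x * y) ≡ σ x * σ y)
    (σ≢0 : ∀ {x} → x ≢ 0# → σ x ≢ 0#)
    (InFq⇒σ-fixed : ∀ {x} → InFq x → σ x ≡ x) (σ-fixed⇒InFq : ∀ {x} → σ x ≡ x → InFq x)
    (ω : K) (σω≢ω : σ ω ≢ ω)
    (U : Pred) where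

    -- Coordinates with respect to the decomposition of the space into the two transversals.
    split : K → K → K → K → V4
    split a c a′ c′ = ⟨ a - a′ , c - c′ , c + c′ , ξ * (a + a′) ⟩

    split-cong : ∀ {a c a′ c′ d e d′ e′} → a ≡ d → c ≡ e → a′ ≡ d′ → c′ ≡ e′ → split a c a′ c′ ≡ split d e d′ e′
    split-cong refl refl refl refl = refl

    split-⊕ : ∀ a c a′ c′ d e d′ e′ → split a c a′ c′ ⊕ split d e d′ e′ ≡ split (a + d) (c + e) (a′ + d′) (c′ + e′)
    split-⊕ a c a′ c′ d e d′ e′ = ⟨⟩-cong (-coordinate a a′ d d′) (-coordinate c c′ e e′) (+coordinate c c′ e e′)
      (solve 5 (λ ξ a a′ d d′ → ξ :* (a :+ a′) :+ ξ :* (d :+ d′) := ξ :* (a :+ d :+ (a′ :+ d′))) refl ξ a a′ d d′)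
      where
      -coordinate : ∀ a a′ d d′ → (a - a′) + (d - d′) ≡ (a + d) - (a′ + d′)
      -coordinate = solve 4 (λ a a′ d d′ → (a :- a′) :+ (d :- d′) := (a :+ d) :- (a′ :+ d′)) refl
      +coordinate : ∀ a a′ d d′ → (a + a′) + (d + d′) ≡ (a + d) + (a′ + d′)
      +coordinate = solve 4 (λ a a′ d d′ → (a :+ a′) :+ (d :+ d′) := (a :+ d) :+ (a′ :+ d′)) refl

    split-• : ∀ k a c a′ c′ → k • split a c a′ c′ ≡ split (k * a) (k * c) (k * a′) (k * c′)
    split-• k a c a′ c′ = ⟨⟩-cong (-coordinate a a′) (-coordinate c c′) (distribˡ k c c′)
      (solve 4 (λ ξ k a a′ → k :* (ξ :* (a :+ a′)) := ξ :* (k :* a :+ k :* a′)) refl ξ k a a′)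
      where
      -coordinate : ∀ a a′ → k * (a - a′) ≡ k * a - k * a′
      -coordinate = solve 3 (λ k a a′ → k :* (a :- a′) := k :* a :- k :* a′) refl k

    split-combination : ∀ j k a c a′ c′ d e d′ e′ →
      (j • split a c a′ c′) ⊕ (k • split d e d′ e′) ≡
      split (j * a + k * d) (j * c + k * e) (j * a′ + k * d′) (j * c′ + k * e′)
    split-combination j k a c a′ c′ d e d′ e′ =
      trans (cong₂ _⊕_ (split-• j a c a′ c′) (split-• k d e d′ e′)) (split-⊕ _ _ _ _ _ _ _ _)

    split-zero : split 0# 0# 0# 0# ≡ zeroV
    split-zero = ⟨⟩-cong (-‿inverseʳ 0#) (-‿inverseʳ 0#) (+-identityʳ 0#)
      (trans (cong (ξ *_) (+-identityʳ 0#)) (zeroʳ ξ))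

    ξ≢0 : ξ ≢ 0#
    ξ≢0 ξ≡0 = ξ-nonSquare 0# (trans (zeroˡ 0#) (sym ξ≡0))

    halves : ∀ {a a′ d d′} → a - a′ ≡ d - d′ → a + a′ ≡ d + d′ → a ≡ d × a′ ≡ d′
    halves {a} {a′} {d} {d′} minus plus =
      *-cancelˡ two≢0 (trans (double a a′) (trans (cong₂ _+_ minus plus) (sym (double d d′)))) ,
      *-cancelˡ two≢0 (trans (double′ a a′) (trans (cong₂ _-_ plus minus) (sym (double′ d d′))))
      where
      double : ∀ a a′ → two * a ≡ (a - a′) + (a + a′)
      double = solve 2 (λ a a′ → (:1 :+ :1) :* a := (a :- a′) :+ (a :+ a′)) refl
      double′ : ∀ a a′ → two * a′ ≡ (a + a′) - (a - a′)
      double′ = solve 2 (λ a a′ → (:1 :+ :1) :* a′ := (a :+ a′) :- (a :- a′)) refl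

    -- Directness of the decomposition: after cancelling ξ in the last coordinate, the sums and
    -- differences are known, and these determine both summands because 2 ≠ 0.
    split-injective : ∀ {a c a′ c′ d e d′ e′} → split a c a′ c′ ≡ split d e d′ e′ →
                      (a ≡ d × c ≡ e) × (a′ ≡ d′ × c′ ≡ e′)
    split-injective eq =
      let a≡d , a′≡d′ = halves (cong V4.c0 eq) (*-cancelˡ ξ≢0 (cong V4.c3 eq))
          c≡e , c′≡e′ = halves (cong V4.c1 eq) (cong V4.c2 eq)
      in (a≡d , c≡e) , (a′≡d′ , c′≡e′)

    split≡0 : ∀ {a c a′ c′} → split a c a′ c′ ≡ zeroV → (a ≡ 0# × c ≡ 0#) × (a′ ≡ 0# × c′ ≡ 0#)
    split≡0 eq = split-injective (trans eq (sym split-zero))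

    τ : K → K
    τ x = b * σ x

    σ-zero : σ 0# ≡ 0#
    σ-zero = InFq⇒σ-fixed InFq-0

    τ-+ : ∀ x y → τ (x + y) ≡ τ x + τ y
    τ-+ x y = trans (cong (b *_) (σ-+ x y)) (distribˡ b (σ x) (σ y))

    τ-* : ∀ x y → τ (x * y) ≡ σ x * τ y
    τ-* x y = trans (cong (b *_) (σ-* x y)) (solve 3 (λ b x y → b :* (x :* y) := x :* (b :* y)) refl b (σ x) (σ y))

    τ≡0⇒≡0 : ∀ {x} → τ x ≡ 0# → x ≡ 0#
    τ≡0⇒≡0 {x} τx≡0 = decidable-stable (x ≟ 0#) λ x≢0 → x*y≢0 b≢0 (σ≢0 x≢0) τx≡0

    graph : K → K → V4
    graph a c = split a c (τ a) (τ c)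

    graph-+ : ∀ a c d e → graph (a + d) (c + e) ≡ graph a c ⊕ graph d e
    graph-+ a c d e = trans (split-cong refl refl (τ-+ a d) (τ-+ c e)) (sym (split-⊕ a c (τ a) (τ c) d e (τ d) (τ e)))

    graph-• : ∀ {k} → InFq k → ∀ a c → graph (k * a) (k * c) ≡ k • graph a c
    graph-• {k} k∈ a c = trans
      (split-cong refl refl (trans (τ-* k a) (cong (_* τ a) (InFq⇒σ-fixed k∈)))
                            (trans (τ-* k c) (cong (_* τ c) (InFq⇒σ-fixed k∈))))
      (sym (split-• k a c (τ a) (τ c)))

    graph≡0 : ∀ {a c} → graph a c ≡ zeroV → a ≡ 0# × c ≡ 0#
    graph≡0 eq = proj₁ (split≡0 eq)

    graph-zero : ∀ {a c} → a ≡ 0# → c ≡ 0# → graph a c ≡ zeroV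
    graph-zero refl refl = trans (split-cong refl refl τ-zero τ-zero) split-zero
      where
      τ-zero : τ 0# ≡ 0#
      τ-zero = trans (cong (b *_) σ-zero) (zeroʳ b)

    -- The first vector only involves the slots a, a′ and the second only c, c′, so a relation falls
    -- apart into two. Serves both for T₁, T₂ and for the points found on an arbitrary transversal.
    transversal-independent : ∀ {s t s′ t′} → split s 0# t 0# ≢ zeroV → split 0# s′ 0# t′ ≢ zeroV →
                              Independent₂ (split s 0# t 0#) (split 0# s′ 0# t′)
    transversal-independent {s} {t} {s′} {t′} v≢0 w≢0 j k eq =
      k•v≡0⇒k≡0 v≢0 (trans (split-• j s 0# t 0#) (trans (split-cong js≡0 (zeroʳ j) jt≡0 (zeroʳ j)) split-zero)) ,
      k•v≡0⇒k≡0 w≢0 (trans (split-• k 0# s′ 0# t′) (trans (split-cong (zeroʳ k) ks′≡0 (zeroʳ k) kt′≡0) split-zero))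
      where
      components = split≡0 (trans (sym (split-combination j k s 0# t 0# 0# s′ 0# t′)) eq)
      dropʳ : ∀ {x y} → x * y + k * 0# ≡ 0# → x * y ≡ 0#
      dropʳ {x} {y} = trans (solve 2 (λ z k → z := z :+ k :* :0) refl (x * y) k)
      dropˡ : ∀ {x y} → j * 0# + x * y ≡ 0# → x * y ≡ 0#
      dropˡ {x} {y} = trans (solve 2 (λ z j → z := j :* :0 :+ z) refl (x * y) j)
      js≡0 = dropʳ (proj₁ (proj₁ components))
      ks′≡0 = dropˡ (proj₂ (proj₁ components))
      jt≡0 = dropʳ (proj₁ (proj₂ components))
      kt′≡0 = dropˡ (proj₂ (proj₂ components))

    -- The two transversals and the quadric

    e₁ e₂ e₃ e₄ : V4
    e₁ = split 1# 0# 0# 0#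
    e₂ = split 0# 1# 0# 0#
    e₃ = split 0# 0# 1# 0#
    e₄ = split 0# 0# 0# 1#

    1≢0 : 1# ≢ 0#
    1≢0 = 0≢1 ∘ sym

    T₁ T₂ : Line
    T₁ = line e₁ e₂ (transversal-independent (1≢0 ∘ proj₁ ∘ proj₁ ∘ split≡0) (1≢0 ∘ proj₂ ∘ proj₁ ∘ split≡0))
    T₂ = line e₃ e₄ (transversal-independent (1≢0 ∘ proj₁ ∘ proj₂ ∘ split≡0) (1≢0 ∘ proj₂ ∘ proj₂ ∘ split≡0))

    x*1+y*0 : ∀ x y → x * 1# + y * 0# ≡ x
    x*1+y*0 = solve 2 (λ x y → x :* :1 :+ y :* :0 := x) refl
    x*0+y*1 : ∀ x y → x * 0# + y * 1# ≡ y
    x*0+y*1 = solve 2 (λ x y → x :* :0 :+ y :* :1 := y) refl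
    x*0+y*0 : ∀ x y → x * 0# + y * 0# ≡ 0#
    x*0+y*0 = solve 2 (λ x y → x :* :0 :+ y :* :0 := :0) refl

    T₁-point : ∀ α β → (α • e₁) ⊕ (β • e₂) ≡ split α β 0# 0#
    T₁-point α β = trans (split-combination α β 1# 0# 0# 0# 0# 1# 0# 0#)
      (split-cong (x*1+y*0 α β) (x*0+y*1 α β) (x*0+y*0 α β) (x*0+y*0 α β))

    T₂-point : ∀ α β → (α • e₃) ⊕ (β • e₄) ≡ split 0# 0# α β
    T₂-point α β = trans (split-combination α β 0# 0# 1# 0# 0# 0# 0# 1#)
      (split-cong (x*0+y*0 α β) (x*0+y*0 α β) (x*1+y*0 α β) (x*0+y*1 α β))

    T₁≢T₂ : ¬ SameLine T₁ T₂
    T₁≢T₂ same =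
      let α , β , e₁≡ = proj₁ (same e₁) (1# , 0# , sym (T₁-point 1# 0#))
      in 1≢0 (proj₁ (proj₁ (split-injective (trans e₁≡ (T₂-point α β)))))

    -- If α ≠ 0, then ξ would be the square of β/α.
    anisotropic : ∀ {α β} → ξ * (α * α) ≡ β * β → α ≡ 0# × β ≡ 0#
    anisotropic {α} {β} eq = α≡0 , β≡0
      where
      α≡0 : α ≡ 0#
      α≡0 = decidable-stable (α ≟ 0#) λ α≢0 →
        let d , α*d≡1 = inverse α α≢0 in ξ-nonSquare (β * d) (begin
          (β * d) * (β * d)              ≡⟨ solve 2 (λ β d → (β :* d) :* (β :* d) := (β :* β) :* (d :* d)) refl β d ⟩
          (β * β) * (d * d)              ≡⟨ cong (_* (d * d)) eq ⟨
          ξ * (α * α) * (d * d)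
            ≡⟨ solve 3 (λ ξ α d → ξ :* (α :* α) :* (d :* d) := ξ :* ((α :* d) :* (α :* d))) refl ξ α d ⟩
          ξ * ((α * d) * (α * d))        ≡⟨ cong (λ z → ξ * (z * z)) α*d≡1 ⟩
          ξ * (1# * 1#)                  ≡⟨ solve 1 (λ ξ → ξ :* (:1 :* :1) := ξ) refl ξ ⟩
          ξ                              ∎)
      β≡0 : β ≡ 0#
      β≡0 = decidable-stable (β ≟ 0#) λ β≢0 → x*y≢0 β≢0 β≢0 (begin
        β * β          ≡⟨ eq ⟨
        ξ * (α * α)    ≡⟨ cong (λ z → ξ * (z * z)) α≡0 ⟩
        ξ * (0# * 0#)  ≡⟨ solve 1 (λ ξ → ξ :* (:0 :* :0) := :0) refl ξ ⟩
        0#             ∎)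

    T₁-external : ExternalToQ T₁
    T₁-external v (α , β , v≡) v≢0 Qv≡0 =
      v≢0 (trans v≡split (trans (split-cong (proj₁ zeros) (proj₂ zeros) refl refl) split-zero))
      where
      v≡split = trans v≡ (T₁-point α β)
      zeros = anisotropic (x-y≡0⇒x≡y (ξ * (α * α)) (β * β) (trans
        -- The right-hand side is `Qform` at `split α β 0# 0#` with its zeros left in place, so that
        -- the next equation applies definitionally.
        (solve 3 (λ ξ α β → ξ :* (α :* α) :- β :* β := (α :- :0) :* (ξ :* (α :+ :0)) :- (β :- :0) :* (β :+ :0)) refl ξ α β)
        (trans (sym (cong Qform v≡split)) Qv≡0)))

    T₂-external : ExternalToQ T₂
    T₂-external v (α , β , v≡) v≢0 Qv≡0 =
      v≢0 (trans v≡split (trans (split-cong refl refl (proj₁ zeros) (proj₂ zeros)) split-zero))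
      where
      v≡split = trans v≡ (T₂-point α β)
      zeros = anisotropic (sym (x-y≡0⇒x≡y (β * β) (ξ * (α * α)) (trans
        (solve 3 (λ ξ α β → β :* β :- ξ :* (α :* α) := (:0 :- α) :* (ξ :* (:0 :+ α)) :- (:0 :- β) :* (:0 :+ β)) refl ξ α β)
        (trans (sym (cong Qform v≡split)) Qv≡0))))

    T₁-T₂-polar : PolarLines T₁ T₂
    T₁-T₂-polar v = T₂⊆T₁⊥ , T₁⊥⊆T₂ v
      where
      T₂⊆T₁⊥ : OnLine T₂ v → ∀ u → OnLine T₁ u → Qpolar u v ≡ 0#
      T₂⊆T₁⊥ (γ , δ , v≡) u (α , β , u≡) = trans
        (cong₂ Qpolar (trans u≡ (T₁-point α β)) (trans v≡ (T₂-point γ δ)))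
        (solve 5 (λ ξ α β γ δ →
          (((α :- :0) :* (ξ :* (:0 :+ γ)) :+ (ξ :* (α :+ :0)) :* (:0 :- γ)) :- (β :- :0) :* (:0 :+ δ))
            :- (β :+ :0) :* (:0 :- δ) := :0)
          refl ξ α β γ δ)
      T₁⊥⊆T₂ : ∀ v → (∀ u → OnLine T₁ u → Qpolar u v ≡ 0#) → OnLine T₂ v
      -- On T₂ the first two coordinates are -α and -β, hence the witnesses. Orthogonality to e₁ and
      -- to e₂ gives y₃ = -ξy₀ and y₂ = -y₁.
      T₁⊥⊆T₂ v@(⟨ y₀ , y₁ , y₂ , y₃ ⟩) polar = - y₀ , - y₁ , trans
        (⟨⟩-cong (x≡0--x y₀) (x≡0--x y₁)
          (x≡0+y y₂ y₁ polar₂)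
          (trans (x≡0+y y₃ (ξ * y₀) polar₁) (solve 2 (λ ξ y → :0 :+ :- (ξ :* y) := ξ :* (:0 :+ :- y)) refl ξ y₀)))
        (sym (T₂-point (- y₀) (- y₁)))
        where
        x≡0--x = solve 1 (λ x → x := :0 :- (:- x)) refl
        x≡0+y : ∀ x y → x + y ≡ 0# → x ≡ 0# + - y
        x≡0+y x y eq = trans (solve 2 (λ x y → x := (x :+ y) :+ :- y) refl x y) (cong (_+ - y) eq)
        polar₁ : y₃ + ξ * y₀ ≡ 0#
        polar₁ = trans
          (solve 5 (λ ξ y₀ y₁ y₂ y₃ → y₃ :+ ξ :* y₀ :=
            (((:1 :- :0) :* y₃ :+ (ξ :* (:1 :+ :0)) :* y₀) :- (:0 :- :0) :* y₂) :- (:0 :+ :0) :* y₁) refl ξ y₀ y₁ y₂ y₃)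
          (polar e₁ (1# , 0# , sym (T₁-point 1# 0#)))
        polar₂ : y₂ + y₁ ≡ 0#
        polar₂ = trans (solve 5 (λ ξ y₀ y₁ y₂ y₃ → y₂ :+ y₁ :=
            :- ((((:0 :- :0) :* y₃ :+ (ξ :* (:0 :+ :0)) :* y₀) :- (:1 :- :0) :* y₂) :- (:1 :+ :0) :* y₁))
            refl ξ y₀ y₁ y₂ y₃)
          (trans (cong (λ z → - z) (polar e₂ (0# , 1# , sym (T₁-point 0# 1#)))) (solve 0 (:- :0 := :0) refl))

    -- Candidate long lines, indexed by the projective line over F_{q^n}

    Point : Set
    Point = Σ (K × K) λ (α , β) → ¬ (α ≡ 0# × β ≡ 0#)

    det : Point → Point → K
    det ((α , β) , _) ((α′ , β′) , _) = α * β′ - β * α′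

    affinePoint : K → Point
    affinePoint β = (1# , β) , 1≢0 ∘ proj₁

    pointAtInfinity : Point
    pointAtInfinity = (0# , 1#) , 1≢0 ∘ proj₂

    finOrInfinity : Fin (q ℕ.^ n) ⊎ Fin 1 → Point
    finOrInfinity (inj₁ i) = affinePoint (element (Fin.cast (sym size≡q^n) i))
    finOrInfinity (inj₂ _) = pointAtInfinity

    -- The q^n normalised points (1, β) and the point (0, 1) represent every point of PG(1, q^n)
    -- once.
    point : Fin (q ℕ.^ n ℕ.+ 1) → Point
    point i = finOrInfinity (splitAt (q ℕ.^ n) i)

    point-affine : ∀ β → ∃ λ i → point i ≡ affinePoint β
    point-affine β = i ↑ˡ 1 , trans (cong finOrInfinity (Fin.splitAt-↑ˡ (q ℕ.^ n) i 1))
      (cong affinePoint (trans (cong element (Fin.cast-involutive (sym size≡q^n) size≡q^n (index β))) (element-index β)))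
      where i = Fin.cast size≡q^n (index β)

    point-infinity : ∃ λ i → point i ≡ pointAtInfinity
    point-infinity = q ℕ.^ n ↑ʳ zero , cong finOrInfinity (Fin.splitAt-↑ʳ (q ℕ.^ n) 1 zero)

    det≡0⇒≡ : ∀ i j → det (point i) (point j) ≡ 0# → i ≡ j
    det≡0⇒≡ i j eq = begin
      i                                             ≡⟨ Fin.join-splitAt (q ℕ.^ n) 1 i ⟨
      join (q ℕ.^ n) 1 (splitAt (q ℕ.^ n) i)
        ≡⟨ cong (join (q ℕ.^ n) 1) (distinct (splitAt (q ℕ.^ n) i) (splitAt (q ℕ.^ n) j) eq) ⟩
      join (q ℕ.^ n) 1 (splitAt (q ℕ.^ n) j)        ≡⟨ Fin.join-splitAt (q ℕ.^ n) 1 j ⟩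
      j                                             ∎
      where
      distinct : ∀ s t → det (finOrInfinity s) (finOrInfinity t) ≡ 0# → s ≡ t
      distinct (inj₁ i) (inj₁ j) eq = cong inj₁ (Fin.toℕ-injective (trans (sym (Fin.toℕ-cast _ i)) (trans
        (cong Fin.toℕ (element-injective (sym (x-y≡0⇒x≡y _ _ (trans (solve 2 (λ x y → y :- x := :1 :* y :- x :* :1) refl
          (element (Fin.cast (sym size≡q^n) i)) (element (Fin.cast (sym size≡q^n) j))) eq))))) (Fin.toℕ-cast _ j))))
      distinct (inj₁ i) (inj₂ _) eq = contradiction
        (trans (solve 1 (λ x → :1 := :1 :* :1 :- x :* :0) refl (element (Fin.cast (sym size≡q^n) i))) eq) 1≢0
      distinct (inj₂ _) (inj₁ j) eq = contradiction
        (trans (solve 1 (λ x → :1 := :- (:0 :* x :- :1 :* :1)) refl (element (Fin.cast (sym size≡q^n) j)))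
          (trans (cong (λ z → - z) eq) (solve 0 (:- :0 := :0) refl))) 1≢0
      distinct (inj₂ zero) (inj₂ zero) _ = refl

    spanningPair : Point → V4 × V4
    spanningPair ((α , β) , _) = split α β 0# 0# , split 0# 0# (σ α) (σ β)

    x*y+z*0 : ∀ x y z → x * y + z * 0# ≡ x * y
    x*y+z*0 = solve 3 (λ x y z → x :* y :+ z :* :0 := x :* y) refl

    x*0+y*z : ∀ x y z → x * 0# + y * z ≡ y * z
    x*0+y*z = solve 3 (λ x y z → x :* :0 :+ y :* z := y :* z) refl

    lineAt-point : ∀ (P : Point) s t → let (α , β) , _ = P in
      (s • proj₁ (spanningPair P)) ⊕ (t • proj₂ (spanningPair P)) ≡ split (s * α) (s * β) (t * σ α) (t * σ β)
    lineAt-point ((α , β) , _) s t = trans (split-combination s t α β 0# 0# 0# 0# (σ α) (σ β))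
      (split-cong (x*y+z*0 s α t) (x*y+z*0 s β t) (x*0+y*z s t (σ α)) (x*0+y*z s t (σ β)))

    x*α≡0×x*β≡0⇒x≡0 : ∀ {x α β} → ¬ (α ≡ 0# × β ≡ 0#) → x * α ≡ 0# → x * β ≡ 0# → x ≡ 0#
    x*α≡0×x*β≡0⇒x≡0 {x} P≢0 xα≡0 xβ≡0 = decidable-stable (x ≟ 0#) λ x≢0 →
      P≢0 (x*y≡0⇒y≡0 x≢0 xα≡0 , x*y≡0⇒y≡0 x≢0 xβ≡0)

    σ≡0⇒≡0 : ∀ {x} → σ x ≡ 0# → x ≡ 0#
    σ≡0⇒≡0 {x} σx≡0 = decidable-stable (x ≟ 0#) λ x≢0 → σ≢0 x≢0 σx≡0

    lineAt : Point → Line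
    lineAt P@((α , β) , P≢0) = line (proj₁ (spanningPair P)) (proj₂ (spanningPair P)) λ s t eq →
      let (sα≡0 , sβ≡0) , (tσα≡0 , tσβ≡0) = split≡0 (trans (sym (lineAt-point P s t)) eq)
      in x*α≡0×x*β≡0⇒x≡0 P≢0 sα≡0 sβ≡0 ,
         x*α≡0×x*β≡0⇒x≡0 (λ (σα≡0 , σβ≡0) → P≢0 (σ≡0⇒≡0 σα≡0 , σ≡0⇒≡0 σβ≡0)) tσα≡0 tσβ≡0

    ℓs : Fin (q ℕ.^ n ℕ.+ 1) → Line
    ℓs i = lineAt (point i)

    -- Replacing s(α, β) by s′(α′, β′) turns s times the determinant into s′(α′β′ - β′α′) = 0.
    det-vanishing : ∀ {s s′ α β α′ β′} → s * α ≡ s′ * α′ → s * β ≡ s′ * β′ → α * β′ - β * α′ ≢ 0# → s ≡ 0#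
    det-vanishing {s} {s′} {α} {β} {α′} {β′} eq₁ eq₂ det≢0 = decidable-stable (s ≟ 0#) λ s≢0 → x*y≢0 s≢0 det≢0 (begin
      s * (α * β′ - β * α′)
        ≡⟨ solve 5 (λ s α β α′ β′ → s :* (α :* β′ :- β :* α′) := (s :* α) :* β′ :- (s :* β) :* α′) refl s α β α′ β′ ⟩
      (s * α) * β′ - (s * β) * α′     ≡⟨ cong₂ (λ x y → x * β′ - y * α′) eq₁ eq₂ ⟩
      (s′ * α′) * β′ - (s′ * β′) * α′ ≡⟨ solve 3 (λ s α β → (s :* α) :* β :- (s :* β) :* α := :0) refl s′ α′ β′ ⟩
      0#                              ∎)

    σ-neg : ∀ x → σ (- x) ≡ - σ x
    σ-neg x = begin
      σ (- x)               ≡⟨ solve 2 (λ x y → y := (x :+ y) :- x) refl (σ x) (σ (- x)) ⟩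
      (σ x + σ (- x)) - σ x ≡⟨ cong (_- σ x) (trans (sym (σ-+ x (- x))) (trans (cong σ (-‿inverseʳ x)) σ-zero)) ⟩
      0# - σ x              ≡⟨ +-identityˡ (- σ x) ⟩
      - σ x                 ∎

    σ-det : ∀ α β α′ β′ → σ (α * β′ - β * α′) ≡ σ α * σ β′ - σ β * σ α′
    σ-det α β α′ β′ = trans (σ-+ (α * β′) (- (β * α′)))
      (cong₂ _+_ (σ-* α β′) (trans (σ-neg (β * α′)) (cong (λ z → - z) (σ-* β α′))))

    -- A common vector has proportional components in T₁ and in T₂. The determinant for the second
    -- pair is σ of the first one, so it is nonzero as well and both components vanish.
    lineAt-disjoint : ∀ P P′ → det P P′ ≢ 0# → DisjointLines (lineAt P) (lineAt P′)
    lineAt-disjoint P@((α , β) , _) P′@((α′ , β′) , _) det≢0 v (s , t , v≡) (s′ , t′ , v≡′) =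
      trans v≡ (trans (cong₂ (λ x y → (x • proj₁ (spanningPair P)) ⊕ (y • proj₂ (spanningPair P))) s≡0 t≡0)
        (trans (cong₂ _⊕_ (0•v≡0 _) (0•v≡0 _)) (⊕-identityˡ zeroV)))
      where
      components = split-injective (trans (sym (lineAt-point P s t)) (trans (sym v≡) (trans v≡′ (lineAt-point P′ s′ t′))))
      s≡0 : s ≡ 0#
      s≡0 = det-vanishing (proj₁ (proj₁ components)) (proj₂ (proj₁ components)) det≢0
      t≡0 : t ≡ 0#
      t≡0 = det-vanishing (proj₁ (proj₂ components)) (proj₂ (proj₂ components))
        λ eq → σ≢0 det≢0 (trans (σ-det α β α′ β′) eq)

    T₁-meets : ∀ P → Meet T₁ (lineAt P)
    T₁-meets P@((α , β) , P≢0) = split α β 0# 0# , P≢0 ∘ proj₁ ∘ split≡0 , (α , β , sym (T₁-point α β)) ,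
      (1# , 0# , sym (trans (lineAt-point P 1# 0#)
        (split-cong (*-identityˡ α) (*-identityˡ β) (zeroˡ (σ α)) (zeroˡ (σ β)))))

    T₂-meets : ∀ P → Meet T₂ (lineAt P)
    T₂-meets P@((α , β) , P≢0) = split 0# 0# (σ α) (σ β) ,
      (λ eq → let _ , (σα≡0 , σβ≡0) = split≡0 eq in P≢0 (σ≡0⇒≡0 σα≡0 , σ≡0⇒≡0 σβ≡0)) ,
      (σ α , σ β , sym (T₂-point (σ α) (σ β))) ,
      (0# , 1# , sym (trans (lineAt-point P 0# 1#)
        (split-cong (zeroˡ α) (zeroˡ β) (*-identityˡ (σ α)) (*-identityˡ (σ β)))))

    -- Lines meeting all members of the family

    affineMeet : ∀ {T} → (∀ i → Meet T (ℓs i)) → ∀ β →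
                 ∃ λ s → ∃ λ t → ¬ (s ≡ 0# × t ≡ 0#) × OnLine T (split s (s * β) t (t * σ β))
    affineMeet {T} meets β =
      let i , point≡ = point-affine β
          v , v≢0 , v∈T , s , t , v≡ = subst (λ P → Meet T (lineAt P)) point≡ (meets i)
          v≡split = trans v≡ (trans (lineAt-point (affinePoint β) s t)
            (split-cong (*-identityʳ s) refl (trans (cong (t *_) (InFq⇒σ-fixed InFq-1)) (*-identityʳ t)) refl))
      in s , t ,
         (λ (s≡0 , t≡0) → v≢0 (trans v≡split (trans (split-cong s≡0 (trans (cong (_* β) s≡0) (zeroˡ β)) t≡0
           (trans (cong (_* σ β) t≡0) (zeroˡ (σ β)))) split-zero))) ,
         subst (OnLine T) v≡split v∈T

    infinityMeet : ∀ {T} → (∀ i → Meet T (ℓs i)) → ∃ λ s → ∃ λ t → split 0# s 0# t ≢ zeroV × OnLine T (split 0# s 0# t)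
    infinityMeet {T} meets =
      let i , point≡ = point-infinity
          v , v≢0 , v∈T , s , t , v≡ = subst (λ P → Meet T (lineAt P)) point≡ (meets i)
          v≡split = trans v≡ (trans (lineAt-point pointAtInfinity s t)
            (split-cong (zeroʳ s) (*-identityʳ s) (trans (cong (t *_) σ-zero) (zeroʳ t))
              (trans (cong (t *_) (InFq⇒σ-fixed InFq-1)) (*-identityʳ t))))
      in s , t , v≢0 ∘ trans v≡split , subst (OnLine T) v≡split v∈T

    -- A line meeting the lines at (1,0), (0,1) and (1,1) is {(s u , t u) : u ∈ K²}.
    frame : ∀ T → (∀ i → Meet T (ℓs i)) →
            ∃ λ s → ∃ λ t → ¬ (s ≡ 0# × t ≡ 0#) × OnLine T (split s 0# t 0#) × OnLine T (split 0# s 0# t)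
    frame T meets =
      let s₀ , t₀ , nonzero₀ , at₀ = affineMeet {T} meets 0#
          s∞ , t∞ , v∞≢0 , v∞∈T = infinityMeet {T} meets
          s , t , nonzero , at₁ = affineMeet {T} meets 1#
          v₀∈T = subst (OnLine T) (split-cong refl (zeroʳ s₀) refl (trans (cong (t₀ *_) σ-zero) (zeroʳ t₀))) at₀
          v₁∈T = subst (OnLine T) (split-cong refl (*-identityʳ s) refl
                   (trans (cong (t *_) (InFq⇒σ-fixed InFq-1)) (*-identityʳ t))) at₁
          v₀≢0 = λ eq → let (s₀≡0 , _) , (t₀≡0 , _) = split≡0 {s₀} {0#} {t₀} {0#} eq in nonzero₀ (s₀≡0 , t₀≡0)
          -- The point over (1,1) is jv₀ + kv∞. Comparing slots gives js₀ = s = ks∞ and jt₀ = t =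
          -- kt∞, so the multiples jv₀ and kv∞ share the pair (s, t).
          j , k , v₁≡ = onSpan T (transversal-independent v₀≢0 v∞≢0) v₀∈T v∞∈T v₁∈T
          (s≡ , s≡′) , (t≡ , t≡′) = split-injective (trans v₁≡ (split-combination j k s₀ 0# t₀ 0# 0# s∞ 0# t∞))
      in s , t , nonzero ,
         subst (OnLine T) (trans (split-• j s₀ 0# t₀ 0#) (split-cong
           (sym (trans s≡ (x*y+z*0 j s₀ k))) (zeroʳ j) (sym (trans t≡ (x*y+z*0 j t₀ k))) (zeroʳ j))) (OnLine-• T v₀∈T j) ,
         subst (OnLine T) (trans (split-• k 0# s∞ 0# t∞) (split-cong
           (zeroʳ k) (sym (trans s≡′ (x*0+y*z j k s∞))) (zeroʳ k) (sym (trans t≡′ (x*0+y*z j k t∞))))) (OnLine-• T v∞∈T k)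

    -- Take a point jv + kw over (1, ω). Its T₁ component forces k = jω when s ≠ 0, and its T₂
    -- component forces k = jσ(ω) when t ≠ 0. With both nonzero, j = 0 and the point would vanish.
    frame-degenerate : ∀ T → (∀ i → Meet T (ℓs i)) → ∀ {s t} → OnLine T (split s 0# t 0#) → OnLine T (split 0# s 0# t) →
                       s ≢ 0# → t ≡ 0#
    frame-degenerate T meets {s} {t} v∈T w∈T s≢0 = decidable-stable (t ≟ 0#) λ t≢0 →
      let s′ , t′ , nonzero , x∈T = affineMeet {T} meets ω
          j , k , x≡ = onSpan T (transversal-independent (λ eq → s≢0 (proj₁ (proj₁ (split≡0 {s} {0#} {t} {0#} eq))))
                                                         (λ eq → s≢0 (proj₂ (proj₁ (split≡0 {0#} {s} {0#} {t} eq)))))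
                              v∈T w∈T x∈T
          (s′≡ , s′ω≡) , (t′≡ , t′σω≡) = split-injective (trans x≡ (split-combination j k s 0# t 0# 0# s 0# t))
          k≡jω = slope {j} {k} s≢0 (trans s′≡ (x*y+z*0 j s k)) (trans s′ω≡ (x*0+y*z j k s))
          k≡jσω = slope {j} {k} t≢0 (trans t′≡ (x*y+z*0 j t k)) (trans t′σω≡ (x*0+y*z j k t))
          j≡0 = decidable-stable (j ≟ 0#) λ j≢0 → σω≢ω (*-cancelˡ j≢0 (trans (sym k≡jσω) k≡jω))
      in nonzero (trans s′≡ (trans (x*y+z*0 j s k) (trans (cong (_* s) j≡0) (zeroˡ s))) ,
                  trans t′≡ (trans (x*y+z*0 j t k) (trans (cong (_* t) j≡0) (zeroˡ t))))
      where
      slope : ∀ {j k x y z} → x ≢ 0# → y ≡ j * x → y * z ≡ k * x → k ≡ j * z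
      slope {j} {k} {x} {y} {z} x≢0 y≡ yz≡ = *-cancelˡ x≢0 (begin
        x * k         ≡⟨ *-comm x k ⟩
        k * x         ≡⟨ yz≡ ⟨
        y * z         ≡⟨ cong (_* z) y≡ ⟩
        j * x * z     ≡⟨ solve 3 (λ j x z → j :* x :* z := x :* (j :* z)) refl j x z ⟩
        x * (j * z)   ∎)

    OnLine-split-• : ∀ T {a c a′ c′ x y x′ y′} k → OnLine T (split a c a′ c′) →
                     k * a ≡ x → k * c ≡ y → k * a′ ≡ x′ → k * c′ ≡ y′ → OnLine T (split x y x′ y′)
    OnLine-split-• T {a} {c} {a′} {c′} k on refl refl refl refl = subst (OnLine T) (split-• k a c a′ c′) (OnLine-• T on k)

    frame-T₁ : ∀ T {s t} → s ≢ 0# → t ≡ 0# → OnLine T (split s 0# t 0#) → OnLine T (split 0# s 0# t) → SameLine T T₁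
    frame-T₁ T {s} {t} s≢0 t≡0 v∈T w∈T = sameLine T (Line.indep T₁)
      (OnLine-split-• T d v∈T d*s≡1 (zeroʳ d) d*t≡0 (zeroʳ d))
      (OnLine-split-• T d w∈T (zeroʳ d) d*s≡1 (zeroʳ d) d*t≡0)
      where
      d = proj₁ (inverse s s≢0)
      d*s≡1 : d * s ≡ 1#
      d*s≡1 = trans (*-comm d s) (proj₂ (inverse s s≢0))
      d*t≡0 : d * t ≡ 0#
      d*t≡0 = trans (cong (d *_) t≡0) (zeroʳ d)

    frame-T₂ : ∀ T {s t} → s ≡ 0# → t ≢ 0# → OnLine T (split s 0# t 0#) → OnLine T (split 0# s 0# t) → SameLine T T₂
    frame-T₂ T {s} {t} s≡0 t≢0 v∈T w∈T = sameLine T (Line.indep T₂)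
      (OnLine-split-• T d v∈T d*s≡0 (zeroʳ d) d*t≡1 (zeroʳ d))
      (OnLine-split-• T d w∈T (zeroʳ d) d*s≡0 (zeroʳ d) d*t≡1)
      where
      d = proj₁ (inverse t t≢0)
      d*t≡1 : d * t ≡ 1#
      d*t≡1 = trans (*-comm d t) (proj₂ (inverse t t≢0))
      d*s≡0 : d * s ≡ 0#
      d*s≡0 = trans (cong (d *_) s≡0) (zeroʳ d)

    transversals : ∀ T → (∀ i → Meet T (ℓs i)) → SameLine T T₁ ⊎ SameLine T T₂
    transversals T meets =
      let s , t , nonzero , v∈T , w∈T = frame T meets
      in classify nonzero v∈T w∈T (s ≟ 0#)
      where
      classify : ∀ {s t} → ¬ (s ≡ 0# × t ≡ 0#) → OnLine T (split s 0# t 0#) → OnLine T (split 0# s 0# t) →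
                 Dec (s ≡ 0#) → SameLine T T₁ ⊎ SameLine T T₂
      classify nonzero v∈T w∈T (no s≢0)  = inj₁ (frame-T₁ T s≢0 (frame-degenerate T meets v∈T w∈T s≢0) v∈T w∈T)
      classify nonzero v∈T w∈T (yes s≡0) = inj₂ (frame-T₂ T s≡0 (λ t≡0 → nonzero (s≡0 , t≡0)) v∈T w∈T)

    -- The linear set as a graph: rank, weights, long lines

    module _ (graph⊆U : ∀ a c → U (graph a c)) (U⊆graph : ∀ {v} → U v → ∃ λ a → ∃ λ c → v ≡ graph a c) where

      graphˡ graphʳ : K → V4
      graphˡ a = graph a 0#
      graphʳ c = graph 0# c

      graphˡ⊕graphʳ : ∀ a c → graphˡ a ⊕ graphʳ c ≡ graph a c
      graphˡ⊕graphʳ a c = trans (sym (graph-+ a 0# 0# c)) (cong₂ graph (+-identityʳ a) (+-identityˡ c))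

      dimension : HasFqDim U (2 ℕ.* n)
      dimension = hasFqDim-2n
        (record { additive    = λ x y → trans (cong (graph (x + y)) (sym (+-identityʳ 0#))) (graph-+ x 0# y 0#)
                ; homogeneous = λ {k} k∈ x → trans (cong (graph (k * x)) (sym (zeroʳ k))) (graph-• k∈ x 0#) })
        (record { additive    = λ x y → trans (cong (λ z → graph z (x + y)) (sym (+-identityʳ 0#))) (graph-+ 0# x 0# y)
                ; homogeneous = λ {k} k∈ x → trans (cong (λ z → graph z (k * x)) (sym (zeroʳ k))) (graph-• k∈ 0# x) })
        (λ a c eq → graph≡0 (trans (sym (graphˡ⊕graphʳ a c)) eq))
        (λ a → graph⊆U a 0#) (λ c → graph⊆U 0# c)
        (λ v v∈U → let a , c , v≡ = U⊆graph v∈U in a , c , trans v≡ (sym (graphˡ⊕graphʳ a c)))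

      -- Semilinearity gives σ(k)τ(x) = kτ(x), and τ(x) ≠ 0 can be cancelled.
      τ-eigenvector : ∀ {k x} → x ≢ 0# → τ (k * x) ≡ k * τ x → InFq k
      τ-eigenvector {k} {x} x≢0 eq = σ-fixed⇒InFq (*-cancelˡ (x≢0 ∘ τ≡0⇒≡0) (begin
        τ x * σ k    ≡⟨ *-comm (τ x) (σ k) ⟩
        σ k * τ x    ≡⟨ τ-* k x ⟨
        τ (k * x)    ≡⟨ eq ⟩
        k * τ x      ≡⟨ *-comm k (τ x) ⟩
        τ x * k      ∎))

      scattered : ∀ {k v} → v ≢ zeroV → U v → U (k • v) → InFq k
      scattered {k} {v} v≢0 v∈U kv∈U =
        let a , c , v≡ = U⊆graph v∈U
            d , e , kv≡ = U⊆graph kv∈U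
            (d≡ , e≡) , (τd≡ , τe≡) = split-injective (trans (sym kv≡) (trans (cong (k •_) v≡) (split-• k a c (τ a) (τ c))))
        in decide a c (λ (a≡0 , c≡0) → v≢0 (trans v≡ (graph-zero a≡0 c≡0)))
             (trans (cong τ (sym d≡)) τd≡) (trans (cong τ (sym e≡)) τe≡) (a ≟ 0#)
        where
        decide : ∀ a c → ¬ (a ≡ 0# × c ≡ 0#) → τ (k * a) ≡ k * τ a → τ (k * c) ≡ k * τ c → Dec (a ≡ 0#) → InFq k
        decide a c nonzero eqa eqc (no a≢0)  = τ-eigenvector a≢0 eqa
        decide a c nonzero eqa eqc (yes a≡0) = τ-eigenvector (λ c≡0 → nonzero (a≡0 , c≡0)) eqc

      pointWeight : ∀ v → v ≢ zeroV → InL U v → HasFqDim (SpanK v ∩ U) 1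
      pointWeight v v≢0 (μ , μv∈U , μv≢0) = (μ • v) ∷ [] ,
        (λ { (c ∷ []) _ eq → k•v≡0⇒k≡0 μv≢0 (trans (sym (⊕-identityʳ (c • (μ • v)))) eq) ∷ [] }) ,
        ((μ , refl) , μv∈U) ∷ [] ,
        -- Relative to the generator μv, the vector kv has coefficient k/μ, which `scattered` places
        -- in F_q.
        λ { w ((k , refl) , kv∈U) → (k * d) ∷ [] ,
            scattered μv≢0 μv∈U (subst U (sym (kd•μv k)) kv∈U) ∷ [] ,
            sym (trans (⊕-identityʳ _) (kd•μv k)) }
        where
        μ≢0 : μ ≢ 0#
        μ≢0 μ≡0 = μv≢0 (trans (cong (_• v) μ≡0) (0•v≡0 v))
        d = proj₁ (inverse μ μ≢0)
        kd•μv : ∀ k → (k * d) • (μ • v) ≡ k • v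
        kd•μv k = trans (sym (•-assoc (k * d) μ v)) (cong (_• v) (begin
          k * d * μ      ≡⟨ solve 3 (λ k d μ → k :* d :* μ := k :* (μ :* d)) refl k d μ ⟩
          k * (μ * d)    ≡⟨ cong (k *_) (proj₂ (inverse μ μ≢0)) ⟩
          k * 1#         ≡⟨ *-identityʳ k ⟩
          k              ∎))

      -- For P = (α, β), the vectors of U with T₁ component xP have T₂ component τ(x)σ(P), so they
      -- lie on this line and are parametrised by x. Conversely, a vector of U on the line is
      -- determined by its T₁ component.
      lineAt-long : ∀ P → LongLine U (lineAt P)
      lineAt-long P@((α , β) , P≢0) = hasFqDim-n {L = L}
        (record { additive    = λ x y → trans (cong₂ graph (distribʳ α x y) (distribʳ β x y))
                                            (graph-+ (x * α) (x * β) (y * α) (y * β))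
                ; homogeneous = λ {k} k∈ x → trans (cong₂ graph (*-assoc k x α) (*-assoc k x β))
                                               (graph-• k∈ (x * α) (x * β)) })
        (λ x eq → let xα≡0 , xβ≡0 = graph≡0 eq in x*α≡0×x*β≡0⇒x≡0 P≢0 xα≡0 xβ≡0)
        (λ x → (x , τ x , trans (split-cong refl refl (τ-*ʳ x α) (τ-*ʳ x β)) (sym (lineAt-point P x (τ x)))) ,
               graph⊆U (x * α) (x * β))
        λ { v ((s , t , v≡) , v∈U) → let a , c , v≡graph = U⊆graph v∈U
                                         (a≡ , c≡) , _ = split-injective (trans (sym v≡graph) (trans v≡ (lineAt-point P s t)))
                                     in s , trans v≡graph (cong₂ graph a≡ c≡) }
        where
        L : K → V4
        L x = graph (x * α) (x * β)
        τ-*ʳ : ∀ x α → τ (x * α) ≡ τ x * σ α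
        τ-*ʳ x α = trans (cong (b *_) (σ-* x α)) (sym (*-assoc b (σ x) (σ α)))

      -- The graph of an injective additive map meets each of the two summands only in zero;
      -- injectivity of τ is used for T₁.
      T₁-disjoint : DisjointFromL U T₁
      T₁-disjoint v (α , β , v≡) _ (μ , μv∈U , μv≢0) =
        let a , c , μv≡ = U⊆graph μv∈U
            _ , (τa≡0 , τc≡0) = split-injective (trans (sym μv≡) (trans (cong (μ •_) (trans v≡ (T₁-point α β)))
                                (split-• μ α β 0# 0#)))
        in μv≢0 (trans μv≡ (graph-zero (τ≡0⇒≡0 (trans τa≡0 (zeroʳ μ))) (τ≡0⇒≡0 (trans τc≡0 (zeroʳ μ)))))

      T₂-disjoint : DisjointFromL U T₂
      T₂-disjoint v (α , β , v≡) _ (μ , μv∈U , μv≢0) =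
        let a , c , μv≡ = U⊆graph μv∈U
            (a≡0 , c≡0) , _ = split-injective (trans (sym μv≡) (trans (cong (μ •_) (trans v≡ (T₂-point α β)))
                              (split-• μ 0# 0# α β)))
        in μv≢0 (trans μv≡ (graph-zero (trans a≡0 (zeroʳ μ)) (trans c≡0 (zeroʳ μ))))

      pseudoregulus : PseudoregulusWith U ℓs T₁ T₂
      pseudoregulus =
        (dimension , pointWeight) ,
        (λ i → lineAt-long (point i)) ,
        (λ i j i≢j → lineAt-disjoint (point i) (point j) (i≢j ∘ det≡0⇒≡ i j)) ,
        (T₁-disjoint , λ i → T₁-meets (point i)) ,
        (T₂-disjoint , λ i → T₂-meets (point i)) ,
        T₁≢T₂ ,
        λ T (_ , meets) → transversals T meets

theorem4p6 : (F : FiniteField) (q n : ℕ) →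
    let open Geom F q n in
    IsPrimePower q → Odd q → 3 ≤ n → Odd n → FiniteField.size F ≡ q ℕ.^ n →
    (ξ : K) → NonSquareFq ξ →
    (r : ℤ) → Coprime n ∣ r ∣ →
    (b : K) → b ≢ 0# → Norm b ≢ 1# → Norm b ≢ - 1# →
    (Hinv : K → K) → (∀ x → H b r (Hinv x) ≡ x) →
    let B : K → K
        B x = two * Hinv x - x
    in
    Σ (Fin (q ℕ.^ n ℕ.+ 1) → Line) λ ℓs →
    Σ Line λ T₁ → Σ Line λ T₂ →
    PseudoregulusWith (DB B ξ) ℓs T₁ T₂ ×
    ExternalToQ T₁ × ExternalToQ T₂ × PolarLines T₁ T₂
theorem4p6 F q n isPrimePower q-odd 3≤n n-odd size≡q^n ξ ξ-nonSquare r n⊥r b b≢0 _ _ Hinv H-Hinv =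
  ℓs , T₁ , T₂ , pseudoregulus graph⊆U U⊆graph , T₁-external , T₂-external , T₁-T₂-polar
  where
  open Geom F q n
  0<n : 0 ℕ.< n
  0<n = ℕ.<-≤-trans (ℕ.s≤s ℕ.z≤n) 3≤n
  1<n : 1 ℕ.< n
  1<n = ℕ.<-≤-trans (ℕ.s≤s (ℕ.s≤s ℕ.z≤n)) 3≤n
  open FieldProperties F q n
  open FrobeniusProperties F q n isPrimePower 0<n size≡q^n
  open FieldExtension F q n isPrimePower 0<n size≡q^n
  open ProjectiveSpace F q n using (⟨⟩-cong)

  σ-fixed⇒InFq : ∀ {x} → frob r x ≡ x → InFq x
  -- Every x is fixed by the n-th iterate of Frobenius; being fixed by a coprime iterate too leaves
  -- only F_q.
  σ-fixed⇒InFq {x} = coprime⇒InFq n (rmod r) (coprime-modN n r 0<n n⊥r) (x^[q^n]≡x x)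

  2≢0 : two ≢ 0#
  2≢0 = two≢0 q-odd

  U : Pred
  U = DB (λ x → two * Hinv x - x) ξ

  ω : ∃ λ x → ¬ InFq x
  ω = ∃-∉Fq 1<n

  open Pseudoregulus F q n isPrimePower 0<n size≡q^n
  open Construction 2≢0 ξ b (nonSquare 2≢0 n-odd ξ-nonSquare) b≢0
    (frob r) ([x+y]^[q^k] (rmod r)) (λ x y → ^-distrib-* x y (q ℕ.^ rmod r)) (λ x≢0 → x^k≢0 x≢0 (q ℕ.^ rmod r))
    (λ x∈Fq → InFq⇒x^[q^k]≡x x∈Fq (rmod r)) σ-fixed⇒InFq (proj₁ ω) (proj₂ ω ∘ σ-fixed⇒InFq) U

  -- Taking both descriptions of a as hypotheses serves both inclusions: one starts from a with x =
  -- H(a), the other from x with a = `Hinv x`.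
  B∘H : ∀ {a x} → Hinv x ≡ a → x ≡ a - τ a → two * Hinv x - x ≡ a + τ a
  B∘H {a} refl x≡ = trans (cong (λ x → two * a - x) x≡)
    (solve 2 (λ a t → (:1 :+ :1) :* a :- (a :- t) := a :+ t) refl a (τ a))

  -- The hypothesis provides one composite only; finiteness of the field provides the other, needed
  -- to start from a parameter a of the graph.
  Hinv-H : ∀ x → Hinv (H b r x) ≡ x
  Hinv-H = leftInverse⇒rightInverse {H b r} {Hinv} H-Hinv

  graph⊆U : ∀ a c → U (graph a c)
  graph⊆U a c = H b r a , H b r c , ⟨⟩-cong refl refl (sym (B∘H (Hinv-H c) refl)) (cong (ξ *_) (sym (B∘H (Hinv-H a) refl)))

  U⊆graph : ∀ {v} → U v → ∃ λ a → ∃ λ c → v ≡ graph a c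
  U⊆graph (x , y , v≡) = Hinv x , Hinv y , trans v≡
    (⟨⟩-cong (sym (H-Hinv x)) (sym (H-Hinv y)) (B∘H refl (sym (H-Hinv y))) (cong (ξ *_) (B∘H refl (sym (H-Hinv x)))))
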